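{- Let $T=(T_k)$ be a polynomially samplable family of finite distributions, with sampling algorithm $\mathsf{SelectFinFam}(k)$. Let $E_T=\{\alpha:T(\alpha)=0\}$ be any emptiness problem and let $U_T=\{\alpha:T(\alpha)=1\}$ be any universality problem such that (i) the problem instances $\alpha$ are descriptions of finite subsets $\mathcal{L}(\alpha)\subseteq X_\alpha$ with polynomially decidable $\mathcal{L}(\alpha)$; (ii) there is a polynomial-time algorithm $\mathsf{distrParameter}(\alpha)$ that returns the index $k$ (in unary) of the distribution $T_k$ that matches the domain of $\alpha$, i.e. $X_\alpha=\mathrm{dom}\,T_k$. Then the algorithm $\mathsf{FinEmptiness}_T(\alpha,\varepsilon)$ is a PRAX algorithm for $E_T$ and the algorithm $\mathsf{FinUniversality}_T(\alpha,\varepsilon)$ is a PRAX algorithm for $U_T$ (both relative to $T$), where the two algorithms are as follows, for $\varepsilon\in(0,1)$. $\mathsf{FinEmptiness}_T(\alpha,\varepsilon)$: Let $c:=4.76603$, $k:=\mathsf{distrParameter}(\alpha)$, $n:=\lceil c/(\varepsilon/2)\rceil$. Repeat $n$ times: let $x:=\mathsf{SelectFinFam}(k)$; if $x\in\mathcal{L}(\alpha)$, return $\mathsf{False}$ (and halt). After the loop, return $\mathsf{True}$. $\mathsf{FinUniversality}_T(\alpha,\varepsilon)$: identical, except that the test "$x\in\mathcal{L}(\alpha)$" is replaced by "$x\notin\mathcal{L}(\alpha)$".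
   Context: Distributions: a probability distribution on a countable set is a function $D$ to $[0,1]$ whose values sum to $1$; $\mathrm{dom}\,D=\{x:D(x)>0\}$; $D(L)=\sum_{x\in L}D(x)$; it is finite if its domain is finite. A family $T=(T_k)$ of finite distributions is polynomially samplable if there is a randomized algorithm $\mathsf{SelectFinFam}(k)$ that selects an element from $T_k$ in time polynomial in $k$, where $k$ is given in unary. Computational model: randomized algorithms with unit cost for arithmetic operations and for tossing a biased coin with given bias. Problem instances: every instance $\alpha$ specifies a finite domain $X_\alpha$ and describes a subset $\mathcal{L}(\alpha)\subseteq X_\alpha$. $\mathcal{L}(\alpha)$ is polynomially decidable means that, given $\alpha$ and $x\in X_\alpha$, whether $x\in\mathcal{L}(\alpha)$ can be decided in time polynomial in the sizes of $\alpha$ and $x$. Write $T(\alpha)$ for $T_k(\mathcal{L}(\alpha))$, where $T_k$ is the distribution associated with $\alpha$. PRAX algorithms: for $\varepsilon\in(0,1)$ let $U_{T,\varepsilon}=\{\alpha:T(\alpha)\ge 1-\varepsilon\}$ and $E_{T,\varepsilon}=\{\alpha: T(\alpha)\le\varepsilon\}$. A PRAX algorithm for $U_T$ (respectively $E_T$) is a randomized algorithm $A(\alpha,\varepsilon)$ that halts on every input with answer $\mathsf{True}$ or $\mathsf{False}$ such that: 1. if $\alpha\in U_T$ (resp. $\alpha\in E_T$) then $A(\alpha,\varepsilon)=\mathsf{True}$; 2. if $\alpha\notin U_{T,\varepsilon}$ (resp. $\alpha\notin E_{T,\varepsilon}$) then $\mathrm{P}[A(\alpha,\varepsilon)=\mathsf{False}]\ge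 3/4$; 3. $A(\alpha,\varepsilon)$ works in time polynomial in $1/\varepsilon$ and the size of $\alpha$. -}

module Defs where

open import Level using (0ℓ)
open import Algebra.Bundles using (CommutativeRing)
import Algebra.Definitions.RawMonoid as RawMonoidDefinitions
import Relation.Binary.Construct.NonStrictToStrict as ToStrict
open import Relation.Binary.Core using (Rel)
open import Relation.Binary.Structures using (IsDecTotalOrder)
open import Relation.Binary.PropositionalEquality using (_≡_; refl)
open import Relation.Nullary using (¬_; does)
open import Relation.Unary using (Pred; Decidable; _⊆_; _≐_)
open import Data.Bool.Base using (Bool; true; false; not; if_then_else_)
import Data.Bool.Properties as Bool
open import Data.Nat.Base as ℕ using (ℕ; zero; suc)
open import Data.Integer.Base using (ℤ; +_; -[1+_])
open import Data.Fin.Base using (Fin)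
open import Data.Vec.Base as Vec using (Vec; []; _∷_)
open import Data.List.Base as List
  using (List; []; _∷_; _++_; length; map; filter; foldr; replicate)
import Data.List.Properties as List
open import Data.List.Membership.Propositional using (_∈_)
open import Data.List.Relation.Unary.All as All using (All; []; _∷_)
import Data.List.Relation.Unary.All.Properties as All
open import Data.List.Relation.Unary.Any using (here; there)
open import Data.List.Relation.Unary.Unique.Propositional using (Unique)
open import Data.Product.Base using (∃; _×_; _,_)
open import Function.Base using (_∘_)
open import Function.Bundles using (_⇔_)

module _ (R : CommutativeRing 0ℓ 0ℓ) where
  open CommutativeRing R
  open RawMonoidDefinitions +-rawMonoid using () renaming (_×_ to _·_)

  natural : ℕ → Carrier
  natural n = n · 1#

  integer : ℤ → Carrier
  integer (+ n)    = natural n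
  integer -[1+ n ] = - natural (suc n)

-- agda-stdlib has no real numbers.  The scalars (probabilities, biases, ε)
-- live in an arbitrary Archimedean ordered field with decidable order, of
-- which ℝ is, classically, an instance.  The ceiling expresses the
-- Archimedean property.
record ArchimedeanField : Set₁ where
  infix  4 _≤_
  infix  8 _⁻¹
  infixl 7 _÷_
  field
    commutativeRing : CommutativeRing 0ℓ 0ℓ
  open CommutativeRing commutativeRing public

  field
    _≤_             : Rel Carrier 0ℓ
    isDecTotalOrder : IsDecTotalOrder _≈_ _≤_
    _⁻¹             : Carrier → Carrier
    0≉1             : ¬ 0# ≈ 1#
    ⁻¹-inverseʳ     : ∀ x → ¬ x ≈ 0# → x * x ⁻¹ ≈ 1#
    ⁻¹-zero         : ∀ x → x ≈ 0# → x ⁻¹ ≈ 0#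
    +-monoˡ-≤       : ∀ x y z → x ≤ y → x + z ≤ y + z
    *-nonNegative   : ∀ x y → 0# ≤ x → 0# ≤ y → 0# ≤ x * y

  open IsDecTotalOrder isDecTotalOrder public using (_≤?_; _≟_)
  open ToStrict _≈_ _≤_ public using (_<_)

  fromℕ : ℕ → Carrier
  fromℕ = natural commutativeRing

  fromℤ : ℤ → Carrier
  fromℤ = integer commutativeRing

  field
    ⌈_⌉     : Carrier → ℤ
    x≤⌈x⌉   : ∀ x → x ≤ fromℤ ⌈ x ⌉
    ⌈x⌉<x+1 : ∀ x → fromℤ ⌈ x ⌉ < x + 1#

  _÷_ : Carrier → Carrier → Carrier
  x ÷ y = x * y ⁻¹

Word : Set
Word = List Bool

unary : ℕ → Word
unary k = replicate k true

-- A set with a coding is countable.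
record Coding (A : Set) : Set where
  field
    code           : A → Word
    code-injective : ∀ {x y} → code x ≡ code y → x ≡ y

  size : A → ℕ
  size = length ∘ code

Finite : {A : Set} → Pred A 0ℓ → Set
Finite P = ∃ λ xs → P ⊆ (_∈ xs)

-- Decidability of 𝓛 is classically vacuous; it is needed to sum over 𝓛 α.
record Problem (Object : Set) : Set₁ where
  field
    Instance  : Set
    instances : Coding Instance
    X         : Instance → Pred Object 0ℓ
    X-finite  : ∀ α → Finite (X α)
    𝓛         : Instance → Pred Object 0ℓ
    𝓛⊆X       : ∀ α → 𝓛 α ⊆ X α
    𝓛?        : ∀ α → Decidable (𝓛 α)

-- Natural coefficients suffice, since polynomials serve only as upper bounds
-- at nonnegative arguments.
data Poly (n : ℕ) : Set where
  con       : ℕ → Poly n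
  var       : Fin n → Poly n
  _:+_ _:*_ : Poly n → Poly n → Poly n

data Ty : Set where
  word num bool : Ty

module Randomized (𝔽 : ArchimedeanField) where
  open ArchimedeanField 𝔽 hiding (refl)

  private variable A B : Set

  evalPoly : ∀ {n} → Poly n → Vec Carrier n → Carrier
  evalPoly (con c)  ρ = fromℕ c
  evalPoly (var i)  ρ = Vec.lookup ρ i
  evalPoly (p :+ q) ρ = evalPoly p ρ + evalPoly q ρ
  evalPoly (p :* q) ρ = evalPoly p ρ * evalPoly q ρ

  ∑ : List A → (A → Carrier) → Carrier
  ∑ xs f = foldr _+_ 0# (map f xs)

  record FiniteDistribution (A : Set) : Set where
    field
      mass : A → Carrier
      0≤mass : ∀ x → 0# ≤ mass x
      mass≤1 : ∀ x → mass x ≤ 1#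

    dom : Pred A 0ℓ
    dom x = 0# < mass x

    field
      support        : List A
      support-unique : Unique support
      support-dom    : ∀ x → x ∈ support ⇔ dom x
      total          : ∑ support mass ≈ 1#

    massOf : {L : Pred A 0ℓ} → Decidable L → Carrier
    massOf L? = ∑ (filter L? support) mass

  -- The coin tosses of a halting computation.  A leaf holds the elapsed time
  -- and the outcome of one branch.  In branch p _ _ h t heads (subtree h) has
  -- probability p.  As p is strictly between 0 and 1, every leaf is reached
  -- with positive probability.
  data Tree (A : Set) : Set where
    leaf   : ℕ → A → Tree A
    branch : (p : Carrier) → 0# < p → p < 1# → Tree A → Tree A → Tree A

  mapTree : (A → B) → Tree A → Tree B
  mapTree f (leaf n a)           = leaf n (f a)
  mapTree f (branch p p>0 p<1 h t) =
    branch p p>0 p<1 (mapTree f h) (mapTree f t)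

  delay : ℕ → Tree A → Tree A
  delay m (leaf n a)           = leaf (m ℕ.+ n) a
  delay m (branch p p>0 p<1 h t) =
    branch p p>0 p<1 (delay m h) (delay m t)

  data Always (P : ℕ → A → Set) : Tree A → Set where
    leaf   : ∀ {n a} → P n a → Always P (leaf n a)
    branch : ∀ {p p>0 p<1 h t} → Always P h → Always P t →
             Always P (branch p p>0 p<1 h t)

  Pr : (A → Bool) → Tree A → Carrier
  Pr E (leaf _ a)         = if E a then 1# else 0#
  Pr E (branch p _ _ h t) = p * Pr E h + (1# - p) * Pr E t

  Pr[_≡ʷ_] : Tree Word → Word → Carrier
  Pr[ t ≡ʷ w ] = Pr (λ v → does (List.≡-dec Bool._≟_ v w)) t

  Pr[_≡ᵇ_] : Tree Bool → Bool → Carrier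
  Pr[ t ≡ᵇ b ] = Pr (λ c → does (c Bool.≟ b)) t

  -- Graft R t u: u arises from t by continuing every leaf of t with a tree
  -- related by R to the outcome at that leaf.
  data Graft (R : A → Tree B → Set) : Tree A → Tree B → Set where
    leaf   : ∀ {n a u} → R a u → Graft R (leaf n a) (delay n u)
    branch : ∀ {p p>0 p<1 h t h′ t′} → Graft R h h′ → Graft R t t′ →
             Graft R (branch p p>0 p<1 h t) (branch p p>0 p<1 h′ t′)

  ⟦_⟧ᵗ : Ty → Set
  ⟦ word ⟧ᵗ = Word
  ⟦ num  ⟧ᵗ = Carrier
  ⟦ bool ⟧ᵗ = Bool

  Ctx : Set
  Ctx = List Ty

  State : Ctx → Set
  State = All ⟦_⟧ᵗ

  private variable
    Γ  : Ctx
    σs : List Ty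
    τ ρ : Ty

  -- head of the empty word is false, its tail is empty, and division by
  -- zero gives zero.  Literals may be arbitrary scalars, so that programs can
  -- toss coins of any given bias.
  data Expr (Γ : Ctx) : Ty → Set where
    var                       : τ ∈ Γ → Expr Γ τ
    nil                       : Expr Γ word
    cons                      : Expr Γ bool → Expr Γ word → Expr Γ word
    tail                      : Expr Γ word → Expr Γ word
    head null                 : Expr Γ word → Expr Γ bool
    bit                       : Bool → Expr Γ bool
    neg                       : Expr Γ bool → Expr Γ bool
    lit                       : Carrier → Expr Γ num
    _∔_ _∸_ _∙_ _⟋_           : Expr Γ num → Expr Γ num → Expr Γ num
    ceil                      : Expr Γ num → Expr Γ num
    _≼_                       : Expr Γ num → Expr Γ num → Expr Γ bool

  infixl 6 _∔_ _∸_
  infixl 7 _∙_ _⟋_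
  infix  4 _≼_

  headWord : Word → Bool
  headWord []      = false
  headWord (b ∷ _) = b

  tailWord : Word → Word
  tailWord []      = []
  tailWord (_ ∷ w) = w

  ⟦_⟧ : Expr Γ τ → State Γ → ⟦ τ ⟧ᵗ
  ⟦ var x ⟧    s = All.lookup s x
  ⟦ nil ⟧      s = []
  ⟦ cons e f ⟧ s = ⟦ e ⟧ s ∷ ⟦ f ⟧ s
  ⟦ tail e ⟧   s = tailWord (⟦ e ⟧ s)
  ⟦ head e ⟧   s = headWord (⟦ e ⟧ s)
  ⟦ null e ⟧   s = List.null (⟦ e ⟧ s)
  ⟦ bit b ⟧    s = b
  ⟦ neg e ⟧    s = not (⟦ e ⟧ s)
  ⟦ lit q ⟧    s = q
  ⟦ e ∔ f ⟧    s = ⟦ e ⟧ s + ⟦ f ⟧ s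
  ⟦ e ∸ f ⟧    s = ⟦ e ⟧ s - ⟦ f ⟧ s
  ⟦ e ∙ f ⟧    s = ⟦ e ⟧ s * ⟦ f ⟧ s
  ⟦ e ⟋ f ⟧    s = ⟦ e ⟧ s ÷ ⟦ f ⟧ s
  ⟦ ceil e ⟧   s = fromℤ ⌈ ⟦ e ⟧ s ⌉
  ⟦ e ≼ f ⟧    s = does (⟦ e ⟧ s ≤? ⟦ f ⟧ s)

  -- Unit cost per operation.  Words are immutable linked lists, hence reading
  -- a word variable takes constant time.
  cost : Expr Γ τ → ℕ
  cost (var _)    = 1
  cost nil        = 1
  cost (cons e f) = 1 ℕ.+ (cost e ℕ.+ cost f)
  cost (tail e)   = 1 ℕ.+ cost e
  cost (head e)   = 1 ℕ.+ cost e
  cost (null e)   = 1 ℕ.+ cost e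
  cost (bit _)    = 1
  cost (neg e)    = 1 ℕ.+ cost e
  cost (lit _)    = 1
  cost (e ∔ f)    = 1 ℕ.+ (cost e ℕ.+ cost f)
  cost (e ∸ f)    = 1 ℕ.+ (cost e ℕ.+ cost f)
  cost (e ∙ f)    = 1 ℕ.+ (cost e ℕ.+ cost f)
  cost (e ⟋ f)    = 1 ℕ.+ (cost e ℕ.+ cost f)
  cost (ceil e)   = 1 ℕ.+ cost e
  cost (e ≼ f)    = 1 ℕ.+ (cost e ℕ.+ cost f)

  ⟦_⟧* : All (Expr Γ) σs → State Γ → State σs
  ⟦ es ⟧* s = All.map (λ e → ⟦ e ⟧ s) es

  cost* : All (Expr Γ) σs → ℕ
  cost* []       = 0
  cost* (e ∷ es) = cost e ℕ.+ cost* es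

  infix  3 _≔_ _≔toss_ _≔call_⟨_⟩
  infixr 2 _⨾_

  mutual
    -- Cmd Γ ρ: commands in an algorithm with variables Γ and answer type ρ.
    data Cmd (Γ : Ctx) (ρ : Ty) : Set where
      skip         : Cmd Γ ρ
      _≔_          : τ ∈ Γ → Expr Γ τ → Cmd Γ ρ
      _≔toss_      : bool ∈ Γ → Expr Γ num → Cmd Γ ρ
      _≔call_⟨_⟩   : τ ∈ Γ → Algorithm σs τ → All (Expr Γ) σs → Cmd Γ ρ
      _⨾_          : Cmd Γ ρ → Cmd Γ ρ → Cmd Γ ρ
      ifThenElse   : Expr Γ bool → Cmd Γ ρ → Cmd Γ ρ → Cmd Γ ρ
      while        : Expr Γ bool → Cmd Γ ρ → Cmd Γ ρ
      return       : Expr Γ ρ → Cmd Γ ρ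

    record Algorithm (σs : List Ty) (τ : Ty) : Set where
      inductive
      constructor algorithm
      field
        locals : List Ty
        body   : Cmd (σs ++ locals) τ

  open Algorithm public

  data Outcome (Γ : Ctx) (ρ : Ty) : Set where
    continue : State Γ → Outcome Γ ρ
    return   : ⟦ ρ ⟧ᵗ → Outcome Γ ρ

  default : ∀ τ → ⟦ τ ⟧ᵗ
  default word = []
  default num  = 0#
  default bool = false

  initial : ∀ {τ} (M : Algorithm σs τ) → State σs → State (σs ++ locals M)
  initial M vs = All.++⁺ vs (All.universal default (locals M))

  infix 1 ⟨_,_⟩⇓_ _⟨_⟩⇓_

  mutual
    -- ⟨ c , s ⟩⇓ t: from state s the command c halts on every sequence of
    -- coin tosses, with tree of outcomes t.  The rules are deterministic: up
    -- to the proofs stored at branches, t is unique.  A toss whose bias is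
    -- outside [0,1] is stuck.
    data ⟨_,_⟩⇓_ {Γ : Ctx} {ρ : Ty} :
                 Cmd Γ ρ → State Γ → Tree (Outcome Γ ρ) → Set where

      skip : ∀ {s} → ⟨ skip , s ⟩⇓ leaf 1 (continue s)

      assign : ∀ {s τ} {x : τ ∈ Γ} {e} →
        ⟨ x ≔ e , s ⟩⇓ leaf (1 ℕ.+ cost e) (continue (s All.[ x ]≔ ⟦ e ⟧ s))

      toss-0 : ∀ {s x e} → ⟦ e ⟧ s ≈ 0# →
        ⟨ x ≔toss e , s ⟩⇓
          leaf (1 ℕ.+ cost e) (continue (s All.[ x ]≔ false))

      toss-1 : ∀ {s x e} → ⟦ e ⟧ s ≈ 1# →
        ⟨ x ≔toss e , s ⟩⇓
          leaf (1 ℕ.+ cost e) (continue (s All.[ x ]≔ true))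

      toss : ∀ {s x e} (p>0 : 0# < ⟦ e ⟧ s) (p<1 : ⟦ e ⟧ s < 1#) →
        ⟨ x ≔toss e , s ⟩⇓
          branch (⟦ e ⟧ s) p>0 p<1
            (leaf (1 ℕ.+ cost e) (continue (s All.[ x ]≔ true)))
            (leaf (1 ℕ.+ cost e) (continue (s All.[ x ]≔ false)))

      call : ∀ {s τ σs} {x : τ ∈ Γ} {M : Algorithm σs τ} {es t} →
        M ⟨ ⟦ es ⟧* s ⟩⇓ t →
        ⟨ x ≔call M ⟨ es ⟩ , s ⟩⇓
          delay (1 ℕ.+ cost* es) (mapTree (λ v → continue (s All.[ x ]≔ v)) t)

      seq : ∀ {s c d t u} → ⟨ c , s ⟩⇓ t → Graft (Then d) t u →
        ⟨ c ⨾ d , s ⟩⇓ u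

      if-true : ∀ {s e c d t} → ⟦ e ⟧ s ≡ true → ⟨ c , s ⟩⇓ t →
        ⟨ ifThenElse e c d , s ⟩⇓ delay (1 ℕ.+ cost e) t

      if-false : ∀ {s e c d t} → ⟦ e ⟧ s ≡ false → ⟨ d , s ⟩⇓ t →
        ⟨ ifThenElse e c d , s ⟩⇓ delay (1 ℕ.+ cost e) t

      while-true : ∀ {s e c t} → ⟦ e ⟧ s ≡ true →
        ⟨ c ⨾ while e c , s ⟩⇓ t →
        ⟨ while e c , s ⟩⇓ delay (1 ℕ.+ cost e) t

      while-false : ∀ {s e c} → ⟦ e ⟧ s ≡ false →
        ⟨ while e c , s ⟩⇓ leaf (1 ℕ.+ cost e) (continue s)

      return : ∀ {s e} →
        ⟨ return e , s ⟩⇓ leaf (1 ℕ.+ cost e) (return (⟦ e ⟧ s))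

    data Then {Γ : Ctx} {ρ : Ty} (d : Cmd Γ ρ) :
              Outcome Γ ρ → Tree (Outcome Γ ρ) → Set where
      continue : ∀ {s u} → ⟨ d , s ⟩⇓ u → Then d (continue s) u
      return   : ∀ {v} → Then d (return v) (leaf 0 (return v))

    -- M ⟨ vs ⟩⇓ t: on input vs the algorithm M halts and answers on every
    -- sequence of coin tosses, with tree of answers t.
    data _⟨_⟩⇓_ {σs : List Ty} {τ : Ty} (M : Algorithm σs τ)
                (vs : State σs) (t : Tree ⟦ τ ⟧ᵗ) : Set where
      run : ⟨ body M , initial M vs ⟩⇓ mapTree return t → M ⟨ vs ⟩⇓ t

  _Within_ : ℕ → Carrier → Set
  n Within b = fromℕ n ≤ b

  Samples : ∀ {Object} → Coding Object → (ℕ → FiniteDistribution Object) →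
            Algorithm (word ∷ []) word → Set
  Samples {Object} objects T M =
    ∃ λ (p : Poly 1) → ∀ k → ∃ λ t →
      (M ⟨ unary k ∷ [] ⟩⇓ t) ×
      (∀ x → Pr[ t ≡ʷ code x ] ≈ mass (T k) x) ×
      Always (λ n _ → n Within evalPoly p (fromℕ k ∷ [])) t
    where
    open Coding objects
    open FiniteDistribution

  module _ {Object : Set} (objects : Coding Object) (Π : Problem Object) where
    open Problem Π
    private
      module Obj  = Coding objects
      module Inst = Coding instances

    PolynomiallyDecides : Algorithm (word ∷ word ∷ []) bool → Set
    PolynomiallyDecides M =
      ∃ λ (p : Poly 2) → ∀ α x → X α x → ∃ λ t →
        (M ⟨ Inst.code α ∷ Obj.code x ∷ [] ⟩⇓ t) ×
        Always (λ n b →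
          b ≡ does (𝓛? α x) ×
          n Within evalPoly p (fromℕ (Inst.size α) ∷ fromℕ (Obj.size x) ∷ [])) t

  module _ {Object : Set} (Π : Problem Object) where
    open Problem Π
    private module Inst = Coding instances

    PolynomiallyComputesUnary :
      (Instance → ℕ) → Algorithm (word ∷ []) word → Set
    PolynomiallyComputesUnary index M =
      ∃ λ (p : Poly 1) → ∀ α → ∃ λ t →
        (M ⟨ Inst.code α ∷ [] ⟩⇓ t) ×
        Always (λ n w →
          w ≡ unary (index α) ×
          n Within evalPoly p (fromℕ (Inst.size α) ∷ [])) t

    -- All leaves of t have positive probability, so that Always expresses an
    -- answer (or a running time bound) that holds with certainty.
    IsPRAX : Pred Instance 0ℓ → (Carrier → Pred Instance 0ℓ) →
             Algorithm (word ∷ num ∷ []) bool → Set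
    IsPRAX S S_ε M =
      ∃ λ (p : Poly 2) → ∀ α ε → 0# < ε → ε < 1# → ∃ λ t →
        (M ⟨ Inst.code α ∷ ε ∷ [] ⟩⇓ t) ×
        (S α → Always (λ _ b → b ≡ true) t) ×
        (¬ S_ε ε α → fromℕ 3 ÷ fromℕ 4 ≤ Pr[ t ≡ᵇ false ]) ×
        Always (λ n _ →
          n Within evalPoly p (ε ⁻¹ ∷ fromℕ (Inst.size α) ∷ [])) t

    module _ (T : ℕ → FiniteDistribution Object) (index : Instance → ℕ) where
      open FiniteDistribution

      -- T(α), where the distribution associated with α is T (index α).
      massOfInstance : Instance → Carrier
      massOfInstance α = massOf (T (index α)) (𝓛? α)

      Emptiness Universality : Pred Instance 0ℓ
      Emptiness    α = massOfInstance α ≈ 0#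
      Universality α = massOfInstance α ≈ 1#

      Emptiness≤ Universality≥ : Carrier → Pred Instance 0ℓ
      Emptiness≤    ε α = massOfInstance α ≤ ε
      Universality≥ ε α = 1# - ε ≤ massOfInstance α

      DomainsMatch : Set
      DomainsMatch = ∀ α → X α ≐ dom (T (index α))

  module SearchVariables where
    vars : Ctx
    vars = word ∷ num ∷ word ∷ word ∷ num ∷ num ∷ bool ∷ []

    α : word ∈ vars
    α = here refl
    ε : num ∈ vars
    ε = there (here refl)
    k x : word ∈ vars
    k = there (there (here refl))
    x = there (there (there (here refl)))
    n i : num ∈ vars
    n = there (there (there (there (here refl))))
    i = there (there (there (there (there (here refl)))))
    b : bool ∈ vars
    b = there (there (there (there (there (there (here refl))))))

  module _ (SelectFinFam   : Algorithm (word ∷ []) word)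
           (decide         : Algorithm (word ∷ word ∷ []) bool)
           (distrParameter : Algorithm (word ∷ []) word) where

    open SearchVariables

    c : Carrier
    c = fromℕ 476603 ÷ fromℕ 100000

    -- The inputs are α and ε; "repeat n times" is a loop with counter i.
    search : Expr vars bool → Algorithm (word ∷ num ∷ []) bool
    search test = algorithm (word ∷ word ∷ num ∷ num ∷ bool ∷ []) (
      k ≔call distrParameter ⟨ var α ∷ [] ⟩ ⨾
      n ≔ ceil (lit c ⟋ (var ε ⟋ lit (fromℕ 2))) ⨾
      i ≔ lit 0# ⨾
      while (neg (var n ≼ var i)) (
        i ≔ var i ∔ lit 1# ⨾
        x ≔call SelectFinFam ⟨ var k ∷ [] ⟩ ⨾
        b ≔call decide ⟨ var α ∷ var x ∷ [] ⟩ ⨾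
        ifThenElse test (return (bit false)) skip) ⨾
      return (bit true))

    FinEmptiness FinUniversality : Algorithm (word ∷ num ∷ []) bool
    FinEmptiness    = search (var b)
    FinUniversality = search (neg (var b))

open Randomized public
  using ( FiniteDistribution; Algorithm; Samples; PolynomiallyDecides
        ; PolynomiallyComputesUnary; DomainsMatch; IsPRAX
        ; Emptiness; Emptiness≤; Universality; Universality≥
        ; FinEmptiness; FinUniversality )

{-# OPTIONS --safe #-}
module Submission where

-- Both algorithms are one random search: sample n objects from the
-- distribution T (index α), and answer false as soon as one of them lies in a
-- decidable set Q, namely 𝓛 α or its complement.  Let p and q be the masses of
-- Q and of its complement, so that p + q = 1.
--
-- Completeness.  The codes of the support receive total probability 1 in the
-- tree of SelectFinFam, and every leaf has positive probability, so every leaf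
-- is the code of an object in the support (sample∈support).  This matters
-- twice: the decision procedure is only ever called on X α, where it is known
-- to halt, and if p = 0 then no sampled object lies in Q.
--
-- Soundness.  One round answers false with probability p, so n rounds do with
-- probability at least hit n, where hit n + q ^ n = 1.  If p > ε, then
-- n p ≥ c / (ε / 2) · ε ≥ 3, and Bernoulli's inequality in the form
-- q ^ n (1 + n p) ≤ 1 gives q ^ n ≤ 1/4 (¾≤hit).
--
-- Running time.  There are at most 10/ε + 1 rounds.  A round calls the sampler,
-- whose time is polynomial in index α, and the decision procedure, whose time is
-- polynomial in the size of α and the length of the sampled word.  Both index α
-- and this length are polynomial in the size of α, because a computation
-- lengthens words by at most one letter per unit of time (⇓-Short).
--
-- Halting, running time, possible outcomes and expected value are derived
-- together, command by command, with the rules for Exec.  The expected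
-- value of a function of the outcome plays the role of a weakest precondition:
-- in c ⨾ d, the function tested after c is the value guaranteed for d.
--
-- Universality follows from the search for the complement of 𝓛 α: its mass is
-- 0 when 𝓛 α has mass 1, and is greater than ε when 𝓛 α has mass below 1 - ε.

open import Defs
open import Data.Nat.Base using (ℕ)
open import Data.List.Base using ([]; _∷_)
open import Data.Product.Base using (_×_)

open import Level using (0ℓ)
open import Data.Bool.Base using (Bool; true; false; not; _∨_; if_then_else_)
open import Data.Bool.ListAction using (any)
import Data.Bool.Properties as Bool
open import Data.Empty using (⊥)
open import Data.Fin.Base using (zero; suc)
import Data.Integer.Base as ℤ
open import Data.List.Base as List using (List; length; filter)
open import Data.List.Membership.Propositional using (_∈_)
open import Data.List.Membership.Propositional.Properties using (∈-filter⁺; ∈-filter⁻)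
import Data.List.Properties as List
open import Data.List.Relation.Unary.All as All using (All; []; _∷_)
import Data.List.Relation.Unary.All.Properties as AllP
open import Data.List.Relation.Unary.AllPairs using ([]; _∷_)
open import Data.List.Relation.Unary.Any using (here; there)
open import Data.List.Relation.Unary.Unique.Propositional using (Unique)
import Data.List.Relation.Unary.Unique.Propositional.Properties as Unique
open import Data.Nat.Base as ℕ using (zero; suc)
import Data.Nat.Properties as ℕ
open import Data.Product.Base using (∃; _,_; proj₁; proj₂)
open import Data.Sum.Base using (_⊎_; inj₁; inj₂)
open import Data.Unit.Base using (⊤; tt)
open import Data.Vec.Base as Vec using (Vec; []; _∷_)
import Data.Vec.Properties as Vec
open import Data.Vec.Relation.Binary.Pointwise.Inductive as Pointwise using (Pointwise; []; _∷_)
open import Function.Bundles using (Equivalence)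
open import Relation.Binary.Bundles using (Poset)
import Relation.Binary.Construct.NonStrictToStrict as ToStrict
open import Relation.Binary.PropositionalEquality as ≡ using (_≡_)
import Relation.Binary.Reasoning.PartialOrder as PartialOrderReasoning
open import Relation.Binary.Structures using (IsDecTotalOrder)
open import Relation.Nullary using (¬_; yes; no; does; contradiction)
open import Relation.Nullary.Decidable using (¬?; dec-true; dec-false)
open import Relation.Unary using (Pred; Decidable)
import Algebra.Properties.Ring as RingProperties
import Algebra.Properties.Semiring.Exp as Exp
import Algebra.Properties.Semiring.Mult as Mult
import Algebra.Solver.Ring.NaturalCoefficients.Default as Solver

-- Arithmetic in an Archimedean ordered field

module FieldProperties (𝔽 : ArchimedeanField) where
  open ArchimedeanField 𝔽 hiding (zero)
  open IsDecTotalOrder isDecTotalOrder public using (antisym; total)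
    renaming (reflexive to ≤-reflexive; refl to ≤-refl; trans to ≤-trans)
  open Mult semiring using (×-homo-+; ×1-homo-*)
  open Exp semiring public using (_^_)
  open RingProperties ring using (-‿distribˡ-*; -‿involutive)

  poset : Poset _ _ _
  poset = record
    { isPartialOrder = IsDecTotalOrder.isPartialOrder isDecTotalOrder }

  module ≤-Reasoning = PartialOrderReasoning poset
  open ≤-Reasoning
  open Solver commutativeSemiring using (solve)
    renaming (_:+_ to _⊕_; _:*_ to _⊗_; _:=_ to _⊜_; con to κ)

  private variable x y z w p q : Carrier

  ≰⇒> : ¬ x ≤ y → y < x
  ≰⇒> = ToStrict.≰⇒> _≈_ _≤_ sym ≤-reflexive total

  <⇒≱ : x < y → ¬ y ≤ x
  <⇒≱ = ToStrict.<⇒≱ _≈_ _≤_ antisym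

  +-monoʳ-≤ : ∀ z → x ≤ y → z + x ≤ z + y
  +-monoʳ-≤ {x} {y} z x≤y = begin
    z + x ≈⟨ +-comm z x ⟩
    x + z ≤⟨ +-monoˡ-≤ x y z x≤y ⟩
    y + z ≈⟨ +-comm y z ⟩
    z + y ∎

  +-mono-≤ : x ≤ y → z ≤ w → x + z ≤ y + w
  +-mono-≤ {x} {y} {z} x≤y z≤w =
    ≤-trans (+-monoˡ-≤ x y z x≤y) (+-monoʳ-≤ y z≤w)

  x-y+y≈x : ∀ x y → x - y + y ≈ x
  x-y+y≈x x y = begin-equality
    x - y + y       ≈⟨ +-assoc x (- y) y ⟩
    x + (- y + y)   ≈⟨ +-congˡ (-‿inverseˡ y) ⟩
    x + 0#          ≈⟨ +-identityʳ x ⟩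
    x               ∎

  x+y-y≈x : ∀ x y → x + y - y ≈ x
  x+y-y≈x x y = begin-equality
    x + y - y       ≈⟨ +-assoc x y (- y) ⟩
    x + (y - y)     ≈⟨ +-congˡ (-‿inverseʳ y) ⟩
    x + 0#          ≈⟨ +-identityʳ x ⟩
    x               ∎

  y+[x-y]≈x : ∀ x y → y + (x - y) ≈ x
  y+[x-y]≈x x y = trans (+-comm y (x - y)) (x-y+y≈x x y)

  +-cancelʳ-≤ : ∀ z → x + z ≤ y + z → x ≤ y
  +-cancelʳ-≤ {x} {y} z x+z≤y+z = begin
    x           ≈⟨ x+y-y≈x x z ⟨
    x + z - z   ≤⟨ +-monoˡ-≤ _ _ (- z) x+z≤y+z ⟩
    y + z - z   ≈⟨ x+y-y≈x y z ⟩
    y           ∎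

  x≤y⇒0≤y-x : x ≤ y → 0# ≤ y - x
  x≤y⇒0≤y-x {x} {y} x≤y = begin
    0#      ≈⟨ -‿inverseʳ x ⟨
    x - x   ≤⟨ +-monoˡ-≤ x y (- x) x≤y ⟩
    y - x   ∎

  x≤x+y : ∀ x → 0# ≤ y → x ≤ x + y
  x≤x+y {y} x 0≤y = begin
    x        ≈⟨ +-identityʳ x ⟨
    x + 0#   ≤⟨ +-monoʳ-≤ x 0≤y ⟩
    x + y    ∎

  +-nonNegative : 0# ≤ x → 0# ≤ y → 0# ≤ x + y
  +-nonNegative {x} 0≤x 0≤y = ≤-trans 0≤x (x≤x+y x 0≤y)

  *-monoʳ-≤ : 0# ≤ z → x ≤ y → z * x ≤ z * y
  *-monoʳ-≤ {z} {x} {y} 0≤z x≤y = begin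
    z * x                 ≤⟨ x≤x+y _ (*-nonNegative z (y - x) 0≤z (x≤y⇒0≤y-x x≤y)) ⟩
    z * x + z * (y - x)   ≈⟨ distribˡ z x (y - x) ⟨
    z * (x + (y - x))     ≈⟨ *-congˡ (y+[x-y]≈x y x) ⟩
    z * y                 ∎

  *-monoˡ-≤ : 0# ≤ z → x ≤ y → x * z ≤ y * z
  *-monoˡ-≤ {z} {x} {y} 0≤z x≤y = begin
    x * z   ≈⟨ *-comm x z ⟩
    z * x   ≤⟨ *-monoʳ-≤ 0≤z x≤y ⟩
    z * y   ≈⟨ *-comm z y ⟩
    y * z   ∎

  *-mono-≤ : 0# ≤ x → x ≤ y → 0# ≤ z → z ≤ w → x * z ≤ y * w
  *-mono-≤ 0≤x x≤y 0≤z z≤w =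
    ≤-trans (*-monoˡ-≤ 0≤z x≤y) (*-monoʳ-≤ (≤-trans 0≤x x≤y) z≤w)

  0≤1 : 0# ≤ 1#
  0≤1 with total 0# 1#
  ... | inj₁ 0≤1 = 0≤1
  ... | inj₂ 1≤0 = begin
    0#              ≤⟨ *-nonNegative _ _ 0≤-1 0≤-1 ⟩
    - 1# * - 1#     ≈⟨ -‿distribˡ-* 1# (- 1#) ⟨
    - (1# * - 1#)   ≈⟨ -‿cong (*-identityˡ (- 1#)) ⟩
    - - 1#          ≈⟨ -‿involutive 1# ⟩
    1#              ∎
    where
    0≤-1 : 0# ≤ - 1#
    0≤-1 = ≤-trans (x≤y⇒0≤y-x 1≤0) (≤-reflexive (+-identityˡ (- 1#)))

  0<1 : 0# < 1#
  0<1 = 0≤1 , 0≉1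

  x⁻¹-inverse : 0# < x → x * x ⁻¹ ≈ 1#
  x⁻¹-inverse {x} (_ , 0≉x) = ⁻¹-inverseʳ x (λ x≈0 → 0≉x (sym x≈0))

  0≤x⁻¹ : 0# < x → 0# ≤ x ⁻¹
  0≤x⁻¹ {x} 0<x with total 0# (x ⁻¹)
  ... | inj₁ 0≤x⁻¹ = 0≤x⁻¹
  ... | inj₂ x⁻¹≤0 = contradiction 1≤0 (<⇒≱ 0<1)
    where
    1≤0 : 1# ≤ 0#
    1≤0 = begin
      1#         ≈⟨ x⁻¹-inverse 0<x ⟨
      x * x ⁻¹   ≤⟨ *-monoʳ-≤ (proj₁ 0<x) x⁻¹≤0 ⟩
      x * 0#     ≈⟨ zeroʳ x ⟩
      0#         ∎

  x÷y*y≈x : 0# < y → x ÷ y * y ≈ x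
  x÷y*y≈x {y} {x} 0<y = begin-equality
    x * y ⁻¹ * y     ≈⟨ *-assoc x (y ⁻¹) y ⟩
    x * (y ⁻¹ * y)   ≈⟨ *-congˡ (trans (*-comm _ _) (x⁻¹-inverse 0<y)) ⟩
    x * 1#           ≈⟨ *-identityʳ x ⟩
    x                ∎

  x*y÷y≈x : 0# < y → x * y ÷ y ≈ x
  x*y÷y≈x {y} {x} 0<y = begin-equality
    x * y * y ⁻¹     ≈⟨ *-assoc x y (y ⁻¹) ⟩
    x * (y * y ⁻¹)   ≈⟨ *-congˡ (x⁻¹-inverse 0<y) ⟩
    x * 1#           ≈⟨ *-identityʳ x ⟩
    x                ∎

  x≤z*y⇒x÷y≤z : 0# < y → x ≤ z * y → x ÷ y ≤ z
  x≤z*y⇒x÷y≤z 0<y x≤zy =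
    ≤-trans (*-monoˡ-≤ (0≤x⁻¹ 0<y) x≤zy) (≤-reflexive (x*y÷y≈x 0<y))

  z*y≤x⇒z≤x÷y : 0# < y → z * y ≤ x → z ≤ x ÷ y
  z*y≤x⇒z≤x÷y 0<y zy≤x =
    ≤-trans (≤-reflexive (sym (x*y÷y≈x 0<y))) (*-monoˡ-≤ (0≤x⁻¹ 0<y) zy≤x)

  x*y≈0⇒y≈0 : 0# < x → x * y ≈ 0# → y ≈ 0#
  x*y≈0⇒y≈0 {x} {y} 0<x xy≈0 = begin-equality
    y            ≈⟨ x*y÷y≈x 0<x ⟨
    y * x ÷ x    ≈⟨ *-congʳ (trans (*-comm y x) xy≈0) ⟩
    0# * x ⁻¹    ≈⟨ zeroˡ (x ⁻¹) ⟩
    0#           ∎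

  0<x*y : 0# < x → 0# < y → 0# < x * y
  0<x*y 0<x 0<y = *-nonNegative _ _ (proj₁ 0<x) (proj₁ 0<y) ,
    λ 0≈xy → proj₂ 0<y (sym (x*y≈0⇒y≈0 0<x (sym 0≈xy)))

  0<x⁻¹ : 0# < x → 0# < x ⁻¹
  0<x⁻¹ {x} 0<x = 0≤x⁻¹ 0<x , λ 0≈x⁻¹ → 0≉1 (begin-equality
    0#         ≈⟨ zeroʳ x ⟨
    x * 0#     ≈⟨ *-congˡ 0≈x⁻¹ ⟩
    x * x ⁻¹   ≈⟨ x⁻¹-inverse 0<x ⟩
    1#         ∎)

  x+y≈0⇒x≈0 : 0# ≤ x → 0# ≤ y → x + y ≈ 0# → x ≈ 0#
  x+y≈0⇒x≈0 {x} 0≤x 0≤y x+y≈0 =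
    antisym (≤-trans (x≤x+y x 0≤y) (≤-reflexive x+y≈0)) 0≤x

  fromℕ-+ : ∀ m n → fromℕ (m ℕ.+ n) ≈ fromℕ m + fromℕ n
  fromℕ-+ = ×-homo-+ 1#

  fromℕ-* : ∀ m n → fromℕ (m ℕ.* n) ≈ fromℕ m * fromℕ n
  fromℕ-* = ×1-homo-*

  0≤fromℕ : ∀ n → 0# ≤ fromℕ n
  0≤fromℕ zero    = ≤-refl
  0≤fromℕ (suc n) = +-nonNegative 0≤1 (0≤fromℕ n)

  fromℕ-mono-≤ : ∀ {m n} → m ℕ.≤ n → fromℕ m ≤ fromℕ n
  fromℕ-mono-≤ {n = n} ℕ.z≤n = 0≤fromℕ n
  fromℕ-mono-≤ (ℕ.s≤s m≤n)   = +-monoʳ-≤ 1# (fromℕ-mono-≤ m≤n)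

  x<1+x : ∀ x → x < 1# + x
  x<1+x x = ≰⇒> λ 1+x≤x → <⇒≱ 0<1 (+-cancelʳ-≤ x
    (≤-trans 1+x≤x (≤-reflexive (sym (+-identityˡ x)))))

  fromℕ-mono-< : ∀ {m n} → m ℕ.< n → fromℕ m < fromℕ n
  fromℕ-mono-< {m} {n} m<n = begin-strict
    fromℕ m         <⟨ x<1+x (fromℕ m) ⟩
    fromℕ (suc m)   ≤⟨ fromℕ-mono-≤ m<n ⟩
    fromℕ n         ∎

  0<fromℕ-suc : ∀ n → 0# < fromℕ (suc n)
  0<fromℕ-suc n = fromℕ-mono-< {0} {suc n} (ℕ.s≤s ℕ.z≤n)

  fromℕ÷fromℕ≤ : ∀ a b d → 0 ℕ.< b → a ℕ.≤ d ℕ.* b → fromℕ a ÷ fromℕ b ≤ fromℕ d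
  fromℕ÷fromℕ≤ a b d 0<b a≤db = x≤z*y⇒x÷y≤z (fromℕ-mono-< 0<b)
    (≤-trans (fromℕ-mono-≤ a≤db) (≤-reflexive (fromℕ-* d b)))

  ≤fromℕ÷fromℕ : ∀ a b d → 0 ℕ.< b → d ℕ.* b ℕ.≤ a → fromℕ d ≤ fromℕ a ÷ fromℕ b
  ≤fromℕ÷fromℕ a b d 0<b db≤a = z*y≤x⇒z≤x÷y (fromℕ-mono-< 0<b)
    (≤-trans (≤-reflexive (sym (fromℕ-* d b))) (fromℕ-mono-≤ db≤a))

  ⌈⌉-natural : 0# < x → ∃ λ n → ⌈ x ⌉ ≡ ℤ.+ n
  ⌈⌉-natural {x} 0<x with ⌈ x ⌉ | x≤⌈x⌉ x
  ... | ℤ.+ n       | _    = n , ≡.refl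
  ... | ℤ.-[1+ n ]  | x≤-n = contradiction x≤0 (<⇒≱ 0<x)
    where
    x≤0 : x ≤ 0#
    x≤0 = begin
      x                                ≤⟨ x≤-n ⟩
      - fromℕ (suc n)                  ≤⟨ x≤x+y _ (0≤fromℕ (suc n)) ⟩
      - fromℕ (suc n) + fromℕ (suc n)  ≈⟨ -‿inverseˡ _ ⟩
      0#                               ∎

  0≤x^n : ∀ n → 0# ≤ x → 0# ≤ x ^ n
  0≤x^n zero    0≤x = 0≤1
  0≤x^n (suc n) 0≤x = *-nonNegative _ _ 0≤x (0≤x^n n 0≤x)

  -- Bernoulli's inequality (1 + p) ^ n ≥ 1 + n p, combined with q (1 + p) ≤ 1,
  -- which holds as q = 1 - p.
  bernoulli : 0# ≤ p → 0# ≤ q → p + q ≈ 1# → ∀ n →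
              q ^ n * (1# + fromℕ n * p) ≤ 1#
  bernoulli {p} {q} 0≤p 0≤q p+q≈1 zero = ≤-reflexive (begin-equality
    1# * (1# + 0# * p)   ≈⟨ *-identityˡ _ ⟩
    1# + 0# * p          ≈⟨ +-congˡ (zeroˡ p) ⟩
    1# + 0#              ≈⟨ +-identityʳ 1# ⟩
    1#                   ∎)
  bernoulli {p} {q} 0≤p 0≤q p+q≈1 (suc n) = begin
    q * q ^ n * (1# + (1# + N) * p)     ≈⟨ solve 4
      (λ q w N p → q ⊗ w ⊗ (κ 1 ⊕ (κ 1 ⊕ N) ⊗ p) ⊜
                   w ⊗ (q ⊗ (κ 1 ⊕ (κ 1 ⊕ N) ⊗ p))) refl q (q ^ n) N p ⟩
    q ^ n * (q * (1# + (1# + N) * p))   ≤⟨ *-monoʳ-≤ (0≤x^n n 0≤q) step ⟩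
    q ^ n * (1# + N * p)                ≤⟨ bernoulli 0≤p 0≤q p+q≈1 n ⟩
    1#                                  ∎
    where
    N = fromℕ n
    -- The two sides differ by (1 + n) p², as q = 1 - p.
    step : q * (1# + (1# + N) * p) ≤ 1# + N * p
    step = begin
      q * (1# + (1# + N) * p)
        ≤⟨ x≤x+y _ (*-nonNegative _ _ (+-nonNegative 0≤1 (0≤fromℕ n))
             (*-nonNegative p p 0≤p 0≤p)) ⟩
      q * (1# + (1# + N) * p) + (1# + N) * (p * p)
        ≈⟨ solve 3 (λ q N p →
             q ⊗ (κ 1 ⊕ (κ 1 ⊕ N) ⊗ p) ⊕ (κ 1 ⊕ N) ⊗ (p ⊗ p) ⊜
             q ⊕ (p ⊕ q) ⊗ p ⊕ N ⊗ ((p ⊕ q) ⊗ p)) refl q N p ⟩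
      q + (p + q) * p + N * ((p + q) * p)
        ≈⟨ +-cong (+-congˡ 1*p) (*-congˡ 1*p) ⟩
      q + p + N * p   ≈⟨ +-congʳ (trans (+-comm q p) p+q≈1) ⟩
      1# + N * p      ∎
      where
      1*p : (p + q) * p ≈ p
      1*p = trans (*-congʳ p+q≈1) (*-identityˡ p)

-- Expected values over trees of coin tosses

module Trees (𝔽 : ArchimedeanField) where
  open ArchimedeanField 𝔽 hiding (zero)
  open FieldProperties 𝔽 hiding (total)
  open Randomized 𝔽 using (Tree; leaf; branch; mapTree; delay; Always; Graft; Pr; ∑)
  open ≤-Reasoning
  open Solver commutativeSemiring using (solve)
    renaming (_:+_ to _⊕_; _:*_ to _⊗_; _:=_ to _⊜_)

  private variable
    A B : Set

  Always-map : {P Q : ℕ → A → Set} → (∀ {n a} → P n a → Q n a) →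
               ∀ {t} → Always P t → Always Q t
  Always-map f (leaf Pa)      = leaf (f Pa)
  Always-map f (branch Ph Pt) = branch (Always-map f Ph) (Always-map f Pt)

  Always-zip : {P Q : ℕ → A → Set} → ∀ {t} → Always P t → Always Q t →
               Always (λ n a → P n a × Q n a) t
  Always-zip (leaf p)     (leaf q)     = leaf (p , q)
  Always-zip (branch p r) (branch q s) =
    branch (Always-zip p q) (Always-zip r s)

  Always-universal : {P : ℕ → A → Set} → (∀ n a → P n a) → ∀ t → Always P t
  Always-universal f (leaf n a)         = leaf (f n a)
  Always-universal f (branch _ _ _ h t) =
    branch (Always-universal f h) (Always-universal f t)

  Always-satisfiable : {P : ℕ → A → Set} → ∀ {t} → Always P t → ∃ λ n → ∃ λ a → P n a
  Always-satisfiable (leaf p)     = _ , _ , p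
  Always-satisfiable (branch p _) = Always-satisfiable p

  Always-delay : {P : ℕ → A → Set} → ∀ m {t} →
                 Always (λ n → P (m ℕ.+ n)) t → Always P (delay m t)
  Always-delay m (leaf p)     = leaf p
  Always-delay m (branch p q) = branch (Always-delay m p) (Always-delay m q)

  Always-mapTree⁺ : {P : ℕ → B → Set} {f : A → B} → ∀ {t} →
                    Always (λ n a → P n (f a)) t → Always P (mapTree f t)
  Always-mapTree⁺ (leaf p)     = leaf p
  Always-mapTree⁺ (branch p q) = branch (Always-mapTree⁺ p) (Always-mapTree⁺ q)

  Always-mapTree⁻ : {P : ℕ → B → Set} {f : A → B} → ∀ t →
                    Always P (mapTree f t) → Always (λ n a → P n (f a)) t
  Always-mapTree⁻ (leaf n a)         (leaf p)     = leaf p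
  Always-mapTree⁻ (branch _ _ _ h t) (branch p q) =
    branch (Always-mapTree⁻ h p) (Always-mapTree⁻ t q)

  -- The expected value of f at the outcome of a computation.
  𝔼 : (A → Carrier) → Tree A → Carrier
  𝔼 f (leaf _ a)         = f a
  𝔼 f (branch p _ _ h t) = p * 𝔼 f h + (1# - p) * 𝔼 f t

  𝔼-delay : ∀ (f : A → Carrier) m t → 𝔼 f (delay m t) ≡ 𝔼 f t
  𝔼-delay f m (leaf _ _)         = ≡.refl
  𝔼-delay f m (branch p _ _ h t) =
    ≡.cong₂ (λ x y → p * x + (1# - p) * y) (𝔼-delay f m h) (𝔼-delay f m t)

  𝔼-mapTree : ∀ (f : B → Carrier) (g : A → B) t → 𝔼 f (mapTree g t) ≡ 𝔼 (λ a → f (g a)) t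
  𝔼-mapTree f g (leaf _ _)         = ≡.refl
  𝔼-mapTree f g (branch p _ _ h t) =
    ≡.cong₂ (λ x y → p * x + (1# - p) * y) (𝔼-mapTree f g h) (𝔼-mapTree f g t)

  branch-mono-≤ : ∀ {p w x y z} → 0# < p → p < 1# → w ≤ x → y ≤ z →
                  p * w + (1# - p) * y ≤ p * x + (1# - p) * z
  branch-mono-≤ 0<p p<1 w≤x y≤z = +-mono-≤
    (*-monoʳ-≤ (proj₁ 0<p) w≤x) (*-monoʳ-≤ (x≤y⇒0≤y-x (proj₁ p<1)) y≤z)

  𝔼-mono : ∀ {f g : A → Carrier} {t} → Always (λ _ a → f a ≤ g a) t → 𝔼 f t ≤ 𝔼 g t
  𝔼-mono (leaf fa≤ga)                           = fa≤ga
  𝔼-mono (branch {p>0 = p>0} {p<1} fh≤gh ft≤gt) =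
    branch-mono-≤ p>0 p<1 (𝔼-mono fh≤gh) (𝔼-mono ft≤gt)

  𝔼-cong : ∀ {f g : A → Carrier} → (∀ a → f a ≈ g a) → ∀ t → 𝔼 f t ≈ 𝔼 g t
  𝔼-cong f≈g (leaf _ a)         = f≈g a
  𝔼-cong f≈g (branch _ _ _ h t) =
    +-cong (*-congˡ (𝔼-cong f≈g h)) (*-congˡ (𝔼-cong f≈g t))

  𝔼-const : ∀ v (t : Tree A) → 𝔼 (λ _ → v) t ≈ v
  𝔼-const v (leaf _ _)         = refl
  𝔼-const v (branch p _ _ h t) = begin-equality
    p * 𝔼 (λ _ → v) h + (1# - p) * 𝔼 (λ _ → v) t
      ≈⟨ +-cong (*-congˡ (𝔼-const v h)) (*-congˡ (𝔼-const v t)) ⟩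
    p * v + (1# - p) * v   ≈⟨ distribʳ v p (1# - p) ⟨
    (p + (1# - p)) * v     ≈⟨ *-congʳ (y+[x-y]≈x 1# p) ⟩
    1# * v                 ≈⟨ *-identityˡ v ⟩
    v                      ∎

  𝔼-+ : ∀ (f g : A → Carrier) t → 𝔼 (λ a → f a + g a) t ≈ 𝔼 f t + 𝔼 g t
  𝔼-+ f g (leaf _ _)         = refl
  𝔼-+ f g (branch p _ _ h t) = begin-equality
    p * 𝔼 (λ a → f a + g a) h + q * 𝔼 (λ a → f a + g a) t
      ≈⟨ +-cong (*-congˡ (𝔼-+ f g h)) (*-congˡ (𝔼-+ f g t)) ⟩
    p * (𝔼 f h + 𝔼 g h) + q * (𝔼 f t + 𝔼 g t)
      ≈⟨ solve 6 (λ p q a b c d → p ⊗ (a ⊕ b) ⊕ q ⊗ (c ⊕ d) ⊜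
           (p ⊗ a ⊕ q ⊗ c) ⊕ (p ⊗ b ⊕ q ⊗ d))
           refl p q (𝔼 f h) (𝔼 g h) (𝔼 f t) (𝔼 g t) ⟩
    (p * 𝔼 f h + q * 𝔼 f t) + (p * 𝔼 g h + q * 𝔼 g t) ∎
    where q = 1# - p

  𝔼-* : ∀ v (f : A → Carrier) t → 𝔼 (λ a → v * f a) t ≈ v * 𝔼 f t
  𝔼-* v f (leaf _ _)         = refl
  𝔼-* v f (branch p _ _ h t) = begin-equality
    p * 𝔼 (λ a → v * f a) h + q * 𝔼 (λ a → v * f a) t
      ≈⟨ +-cong (*-congˡ (𝔼-* v f h)) (*-congˡ (𝔼-* v f t)) ⟩
    p * (v * 𝔼 f h) + q * (v * 𝔼 f t)
      ≈⟨ solve 5 (λ p q v a b → p ⊗ (v ⊗ a) ⊕ q ⊗ (v ⊗ b) ⊜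
           v ⊗ (p ⊗ a ⊕ q ⊗ b)) refl p q v (𝔼 f h) (𝔼 f t) ⟩
    v * (p * 𝔼 f h + q * 𝔼 f t) ∎
    where q = 1# - p

  -- The indicator of an event.
  𝟙 : Bool → Carrier
  𝟙 b = if b then 1# else 0#

  Pr≡𝔼 : ∀ (E : A → Bool) t → Pr E t ≡ 𝔼 (λ a → 𝟙 (E a)) t
  Pr≡𝔼 E (leaf _ _)         = ≡.refl
  Pr≡𝔼 E (branch p _ _ h t) =
    ≡.cong₂ (λ x y → p * x + (1# - p) * y) (Pr≡𝔼 E h) (Pr≡𝔼 E t)

  0≤𝟙 : ∀ b → 0# ≤ 𝟙 b
  0≤𝟙 true  = 0≤1
  0≤𝟙 false = ≤-refl

  0≤Pr : ∀ (E : A → Bool) t → 0# ≤ Pr E t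
  0≤Pr E t = begin
    0#                      ≈⟨ 𝔼-const 0# t ⟨
    𝔼 (λ _ → 0#) t          ≤⟨ 𝔼-mono (Always-universal (λ _ a → 0≤𝟙 (E a)) t) ⟩
    𝔼 (λ a → 𝟙 (E a)) t     ≡⟨ Pr≡𝔼 E t ⟨
    Pr E t                  ∎

  Pr+Pr-not≈1 : ∀ (E : A → Bool) t → Pr E t + Pr (λ a → not (E a)) t ≈ 1#
  Pr+Pr-not≈1 E t = begin-equality
    Pr E t + Pr (λ a → not (E a)) t
      ≡⟨ ≡.cong₂ _+_ (Pr≡𝔼 E t) (Pr≡𝔼 (λ a → not (E a)) t) ⟩
    𝔼 (λ a → 𝟙 (E a)) t + 𝔼 (λ a → 𝟙 (not (E a))) t   ≈⟨ 𝔼-+ _ _ t ⟨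
    𝔼 (λ a → 𝟙 (E a) + 𝟙 (not (E a))) t   ≈⟨ 𝔼-cong (λ a → 𝟙-not (E a)) t ⟩
    𝔼 (λ _ → 1#) t                        ≈⟨ 𝔼-const 1# t ⟩
    1#                                    ∎
    where
    𝟙-not : ∀ b → 𝟙 b + 𝟙 (not b) ≈ 1#
    𝟙-not true  = +-identityʳ 1#
    𝟙-not false = +-identityˡ 1#

  -- This holds because every leaf has positive probability.
  Pr≈0⇒never : ∀ (E : A → Bool) t → Pr E t ≈ 0# → Always (λ _ a → E a ≡ false) t
  Pr≈0⇒never E (leaf _ a) 1a≈0 with E a in Ea
  ... | false = leaf Ea
  ... | true  = contradiction (sym 1a≈0) 0≉1
  Pr≈0⇒never E (branch p p>0 p<1 h t) Pr≈0 = branch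
    (Pr≈0⇒never E h (x*y≈0⇒y≈0 p>0 (x+y≈0⇒x≈0 0≤ph 0≤qt Pr≈0)))
    (Pr≈0⇒never E t (x*y≈0⇒y≈0 0<q (x+y≈0⇒x≈0 0≤qt 0≤ph (trans (+-comm _ _) Pr≈0))))
    where
    q = 1# - p
    0<q : 0# < q
    0<q = x≤y⇒0≤y-x (proj₁ p<1) , λ 0≈q → proj₂ p<1 (begin-equality
      p        ≈⟨ +-identityʳ p ⟨
      p + 0#   ≈⟨ +-congˡ 0≈q ⟩
      p + q    ≈⟨ y+[x-y]≈x 1# p ⟩
      1#       ∎)
    0≤ph : 0# ≤ p * Pr E h
    0≤ph = *-nonNegative _ _ (proj₁ p>0) (0≤Pr E h)
    0≤qt : 0# ≤ q * Pr E t
    0≤qt = *-nonNegative _ _ (proj₁ 0<q) (0≤Pr E t)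

  Pr≈1⇒always : ∀ (E : A → Bool) t → Pr E t ≈ 1# → Always (λ _ a → E a ≡ true) t
  Pr≈1⇒always E t Pr≈1 = Always-map Bool.not-injective
    (Pr≈0⇒never (λ a → not (E a)) t (begin-equality
      Pr not-E t                    ≈⟨ x+y-y≈x (Pr not-E t) (Pr E t) ⟨
      Pr not-E t + Pr E t - Pr E t  ≈⟨ +-congʳ (trans (+-comm _ _) (Pr+Pr-not≈1 E t)) ⟩
      1# - Pr E t                   ≈⟨ +-congʳ Pr≈1 ⟨
      Pr E t - Pr E t               ≈⟨ -‿inverseʳ (Pr E t) ⟩
      0#                            ∎))
    where not-E = λ a → not (E a)

  -- If every outcome a with P has a continuation for which h has expected value
  -- at least g a, then after these continuations h has at least the expected
  -- value of g.
  graft : ∀ {R : A → Tree B → Set} {P : ℕ → A → Set} {Q : ℕ → B → Set}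
            {g : A → Carrier} {h : B → Carrier} {t} → Always P t →
          (∀ {n a} → P n a → ∃ λ u →
            R a u × Always (λ m → Q (n ℕ.+ m)) u × g a ≤ 𝔼 h u) →
          ∃ λ u → Graft R t u × Always Q u × 𝔼 g t ≤ 𝔼 h u
  graft {h = h} (leaf {n} Pa) next with next Pa
  ... | u , Rau , Qu , ga≤𝔼hu = delay n u , leaf Rau , Always-delay n Qu ,
    ≤-trans ga≤𝔼hu (≤-reflexive (reflexive (≡.sym (𝔼-delay h n u))))
  graft (branch {p>0 = p>0} {p<1} Ph Pt) next
    with graft Ph next | graft Pt next
  ... | u , G , Qu , g≤ | u′ , G′ , Qu′ , g≤′ =
    _ , branch {p>0 = p>0} {p<1} G G′ , branch Qu Qu′ ,
    branch-mono-≤ p>0 p<1 g≤ g≤′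

  ∑-cong : ∀ {f g : A → Carrier} → (∀ x → f x ≈ g x) → ∀ xs → ∑ xs f ≈ ∑ xs g
  ∑-cong f≈g []       = refl
  ∑-cong f≈g (x ∷ xs) = +-cong (f≈g x) (∑-cong f≈g xs)

  0≤∑ : ∀ {f : A → Carrier} → (∀ x → 0# ≤ f x) → ∀ xs → 0# ≤ ∑ xs f
  0≤∑ 0≤f []       = ≤-refl
  0≤∑ 0≤f (x ∷ xs) = +-nonNegative (0≤f x) (0≤∑ 0≤f xs)

  f[x]≤∑ : ∀ {f : A → Carrier} → (∀ x → 0# ≤ f x) → ∀ {x xs} → x ∈ xs → f x ≤ ∑ xs f
  f[x]≤∑ 0≤f {xs = x ∷ xs} (here ≡.refl) = x≤x+y _ (0≤∑ 0≤f xs)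
  f[x]≤∑ {f = f} 0≤f {x} {y ∷ xs} (there x∈xs) = begin
    f x            ≤⟨ f[x]≤∑ 0≤f x∈xs ⟩
    ∑ xs f         ≤⟨ x≤x+y _ (0≤f y) ⟩
    ∑ xs f + f y   ≈⟨ +-comm _ _ ⟩
    f y + ∑ xs f   ∎

  ∑-filter-split : {P : Pred A 0ℓ} (P? : Decidable P) (f : A → Carrier) → ∀ xs →
                   ∑ (filter P? xs) f + ∑ (filter (λ x → ¬? (P? x)) xs) f ≈ ∑ xs f
  ∑-filter-split P? f []       = +-identityˡ 0#
  ∑-filter-split P? f (x ∷ xs) with does (P? x)
  ... | true  = trans (+-assoc _ _ _) (+-congˡ (∑-filter-split P? f xs))
  ... | false = begin-equality
    s + (f x + s′)   ≈⟨ solve 3 (λ s y s′ → s ⊕ (y ⊕ s′) ⊜ y ⊕ (s ⊕ s′)) refl s (f x) s′ ⟩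
    f x + (s + s′)   ≈⟨ +-congˡ (∑-filter-split P? f xs) ⟩
    f x + ∑ xs f     ∎
    where
    s  = ∑ (filter P? xs) f
    s′ = ∑ (filter (λ y → ¬? (P? y)) xs) f

-- Masses of complementary sets under a finite distribution

module Masses (𝔽 : ArchimedeanField) {Object : Set} (D : FiniteDistribution 𝔽 Object)
              {L : Pred Object 0ℓ} (L? : Decidable L) where
  open ArchimedeanField 𝔽 hiding (zero)
  open FieldProperties 𝔽 hiding (total)
  open Trees 𝔽
  open Randomized.FiniteDistribution D
  open ≤-Reasoning

  private
    L̄? : Decidable (λ x → ¬ L x)
    L̄? x = ¬? (L? x)

  massOf-complement : massOf L? + massOf L̄? ≈ 1#
  massOf-complement = trans (∑-filter-split L? mass support) total

  0≤massOf : 0# ≤ massOf L?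
  0≤massOf = 0≤∑ 0≤mass (filter L? support)

  massOf≈0⇒disjoint : massOf L? ≈ 0# → ∀ {x} → x ∈ support → ¬ L x
  massOf≈0⇒disjoint massOf≈0 {x} x∈support Lx =
    proj₂ (Equivalence.to (support-dom x) x∈support)
    (antisym (0≤mass x) (begin
      mass x      ≤⟨ f[x]≤∑ 0≤mass (∈-filter⁺ L? x∈support Lx) ⟩
      massOf L?   ≈⟨ massOf≈0 ⟩
      0#          ∎))

  massOf≈1⇒complement≈0 : massOf L? ≈ 1# → massOf L̄? ≈ 0#
  massOf≈1⇒complement≈0 massOf≈1 = begin-equality
    massOf L̄?                           ≈⟨ x+y-y≈x (massOf L̄?) (massOf L?) ⟨
    massOf L̄? + massOf L? - massOf L?   ≈⟨ +-cong (trans (+-comm _ _) massOf-complement) (-‿cong massOf≈1) ⟩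
    1# - 1#                             ≈⟨ -‿inverseʳ 1# ⟩
    0#                                  ∎

  complement≤⇒1-≤massOf : ∀ {ε} → massOf L̄? ≤ ε → 1# - ε ≤ massOf L?
  complement≤⇒1-≤massOf {ε} massOf≤ε = +-cancelʳ-≤ ε (begin
    1# - ε + ε              ≈⟨ x-y+y≈x 1# ε ⟩
    1#                      ≈⟨ massOf-complement ⟨
    massOf L? + massOf L̄?   ≤⟨ +-monoʳ-≤ (massOf L?) massOf≤ε ⟩
    massOf L? + ε           ∎)

-- Sampling trees for a finite distribution

module Distributions (𝔽 : ArchimedeanField) {Object : Set} (objects : Coding Object) where
  open ArchimedeanField 𝔽 hiding (zero)
  open FieldProperties 𝔽 hiding (total)
  open Trees 𝔽
  open Randomized 𝔽 using (Tree; Always; Pr; Pr[_≡ʷ_]; ∑)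
  open Coding objects
  open ≤-Reasoning

  -- The event that a word is the code of an object in a given list.
  isCodeIn : List Object → Word → Bool
  isCodeIn xs w = any (λ x → does (List.≡-dec Bool._≟_ w (code x))) xs

  isCodeIn-sound : ∀ xs {w} → isCodeIn xs w ≡ true → ∃ λ x → x ∈ xs × w ≡ code x
  isCodeIn-sound (x ∷ xs) {w} w∈ with List.≡-dec Bool._≟_ w (code x)
  ... | yes w≡x = x , here ≡.refl , w≡x
  ... | no  _   with isCodeIn-sound xs w∈
  ...   | y , y∈xs , w≡y = y , there y∈xs , w≡y

  isCodeIn-complete : ∀ {xs x} → x ∈ xs → isCodeIn xs (code x) ≡ true
  isCodeIn-complete {y ∷ xs} {x} x∈ with List.≡-dec Bool._≟_ (code x) (code y) | x∈
  ... | yes _ | _          = ≡.refl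
  ... | no  x≢y | here x≡y = contradiction (≡.cong code x≡y) x≢y
  ... | no  _ | there x∈xs = isCodeIn-complete x∈xs

  -- For distinct x, the events that the word is the code of x are disjoint,
  -- because codes are injective.
  Pr-isCodeIn : ∀ {xs} → Unique xs → ∀ t →
                Pr (isCodeIn xs) t ≈ ∑ xs (λ x → Pr[ t ≡ʷ code x ])
  Pr-isCodeIn {[]} [] t = begin-equality
    Pr (λ _ → false) t   ≡⟨ Pr≡𝔼 (λ _ → false) t ⟩
    𝔼 (λ _ → 0#) t       ≈⟨ 𝔼-const 0# t ⟩
    0#                   ∎
  Pr-isCodeIn {x ∷ xs} (x∉xs ∷ unique) t = begin-equality
    Pr (λ w → is w ∨ isCodeIn xs w) t                  ≡⟨ Pr≡𝔼 (λ w → is w ∨ isCodeIn xs w) t ⟩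
    𝔼 (λ w → 𝟙 (is w ∨ isCodeIn xs w)) t               ≈⟨ 𝔼-cong disjoint t ⟩
    𝔼 (λ w → 𝟙 (is w) + 𝟙 (isCodeIn xs w)) t           ≈⟨ 𝔼-+ _ _ t ⟩
    𝔼 (λ w → 𝟙 (is w)) t + 𝔼 (λ w → 𝟙 (isCodeIn xs w)) t
      ≡⟨ ≡.cong₂ _+_ (Pr≡𝔼 is t) (Pr≡𝔼 (isCodeIn xs) t) ⟨
    Pr is t + Pr (isCodeIn xs) t                       ≈⟨ +-congˡ (Pr-isCodeIn unique t) ⟩
    Pr is t + ∑ xs (λ y → Pr[ t ≡ʷ code y ])           ∎
    where
    is : Word → Bool
    is w = does (List.≡-dec Bool._≟_ w (code x))
    disjoint : ∀ w → 𝟙 (is w ∨ isCodeIn xs w) ≈ 𝟙 (is w) + 𝟙 (isCodeIn xs w)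
    disjoint w with List.≡-dec Bool._≟_ w (code x) | isCodeIn xs w in w∈xs
    ... | no  _ | _     = sym (+-identityˡ _)
    ... | yes _ | false = sym (+-identityʳ _)
    ... | yes w≡x | true with isCodeIn-sound xs w∈xs
    ...   | y , y∈xs , w≡y = contradiction
      (code-injective (≡.trans (≡.sym w≡x) w≡y)) (All.lookup x∉xs y∈xs)

  isCodeIn-filter : ∀ {xs} {L : Pred Object 0ℓ} (L? : Decidable L) → ∀ {x} → x ∈ xs →
                    isCodeIn (filter L? xs) (code x) ≡ does (L? x)
  isCodeIn-filter {xs} L? {x} x∈ with L? x | isCodeIn (filter L? xs) (code x) in eq
  ... | yes _  | true  = ≡.refl
  ... | no  _  | false = ≡.refl
  ... | yes Lx | false =
    ≡.trans (≡.sym eq) (isCodeIn-complete (∈-filter⁺ L? x∈ Lx))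
  ... | no ¬Lx | true with isCodeIn-sound (filter L? xs) eq
  ...   | y , y∈ , x≡y with code-injective x≡y
  ...     | ≡.refl = contradiction (proj₂ (∈-filter⁻ L? {xs = xs} y∈)) ¬Lx

  -- Facts about any tree whose outcomes are distributed as the codes of objects
  -- drawn from D.
  module Sampling (D : FiniteDistribution 𝔽 Object) {t : Tree Word}
                  (samples : ∀ x → Pr[ t ≡ʷ code x ] ≈ Randomized.FiniteDistribution.mass D x) where
    open Randomized.FiniteDistribution D

    Pr-sample∈ : {L : Pred Object 0ℓ} (L? : Decidable L) →
                 Pr (isCodeIn (filter L? support)) t ≈ massOf L?
    Pr-sample∈ L? = trans (Pr-isCodeIn (Unique.filter⁺ L? support-unique) t)
                          (∑-cong samples (filter L? support))

    sample∈support : Always (λ _ w → ∃ λ x → x ∈ support × w ≡ code x) t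
    sample∈support = Always-map (isCodeIn-sound support)
      (Pr≈1⇒always (isCodeIn support) t
        (trans (Pr-isCodeIn support-unique t) (trans (∑-cong samples support) total)))

-- Polynomial bounds

-- Substitution of polynomials for the variables of a polynomial.
infixl 21 _[_]
_[_] : ∀ {m n} → Poly n → Vec (Poly m) n → Poly m
con c    [ σ ] = con c
var i    [ σ ] = Vec.lookup σ i
(p :+ q) [ σ ] = p [ σ ] :+ q [ σ ]
(p :* q) [ σ ] = p [ σ ] :* q [ σ ]

module Polynomials (𝔽 : ArchimedeanField) where
  open ArchimedeanField 𝔽 hiding (zero)
  open FieldProperties 𝔽
  open Randomized 𝔽 using (evalPoly)

  evalPoly-[] : ∀ {m n} (p : Poly n) (σ : Vec (Poly m) n) ρ →
                evalPoly (p [ σ ]) ρ ≡ evalPoly p (Vec.map (λ q → evalPoly q ρ) σ)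
  evalPoly-[] (con c)  σ ρ = ≡.refl
  evalPoly-[] (var i)  σ ρ = ≡.sym (Vec.lookup-map i (λ q → evalPoly q ρ) σ)
  evalPoly-[] (p :+ q) σ ρ = ≡.cong₂ _+_ (evalPoly-[] p σ ρ) (evalPoly-[] q σ ρ)
  evalPoly-[] (p :* q) σ ρ = ≡.cong₂ _*_ (evalPoly-[] p σ ρ) (evalPoly-[] q σ ρ)

  -- Polynomials with natural coefficients are monotone only at nonnegative
  -- arguments, so that nonnegativity is carried along.
  infix 4 _0≤≤_
  _0≤≤_ : Carrier → Carrier → Set
  x 0≤≤ y = 0# ≤ x × x ≤ y

  evalPoly-0≤≤ : ∀ {n} (p : Poly n) {ρ σ} → Pointwise _0≤≤_ ρ σ →
                 evalPoly p ρ 0≤≤ evalPoly p σ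
  evalPoly-0≤≤ (con c)  ρ≤σ = 0≤fromℕ c , ≤-refl
  evalPoly-0≤≤ (var i)  ρ≤σ = Pointwise.lookup ρ≤σ i
  evalPoly-0≤≤ (p :+ q) ρ≤σ with evalPoly-0≤≤ p ρ≤σ | evalPoly-0≤≤ q ρ≤σ
  ... | 0≤x , x≤y | 0≤z , z≤w = +-nonNegative 0≤x 0≤z , +-mono-≤ x≤y z≤w
  evalPoly-0≤≤ (p :* q) ρ≤σ with evalPoly-0≤≤ p ρ≤σ | evalPoly-0≤≤ q ρ≤σ
  ... | 0≤x , x≤y | 0≤z , z≤w = *-nonNegative _ _ 0≤x 0≤z , *-mono-≤ 0≤x x≤y 0≤z z≤w

  evalPoly-mono : ∀ {n} (p : Poly n) {ρ σ} → Pointwise _0≤≤_ ρ σ →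
                  evalPoly p ρ ≤ evalPoly p σ
  evalPoly-mono p ρ≤σ = proj₂ (evalPoly-0≤≤ p ρ≤σ)

-- Growth of words during a computation

module WordLengths (𝔽 : ArchimedeanField) where
  open Randomized 𝔽 hiding
    ( FiniteDistribution; Algorithm; Samples; PolynomiallyDecides
    ; PolynomiallyComputesUnary; DomainsMatch; IsPRAX
    ; Emptiness; Emptiness≤; Universality; Universality≥
    ; FinEmptiness; FinUniversality; c )
  open Trees 𝔽
  open import Data.Nat.Base using (_+_; _≤_; z≤n; s≤s)

  private variable
    Γ Δ : Ctx
    τ ρ : Ty

  -- The length of a word; scalars and Booleans count as empty.
  wordLength : ∀ τ → ⟦ τ ⟧ᵗ → ℕ
  wordLength word w = length w
  wordLength num  _ = 0
  wordLength bool _ = 0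

  -- Short m s: all words in the state s have length at most m.
  data Short (m : ℕ) : State Γ → Set where
    []  : Short m []
    _∷_ : ∀ {v : ⟦ τ ⟧ᵗ} {s : State Γ} → wordLength τ v ≤ m → Short m s →
          Short m {τ ∷ Γ} (v ∷ s)

  -- The same for an outcome: the final state or the returned value.
  ShortOutcome : ℕ → Outcome Γ ρ → Set
  ShortOutcome         m (continue s) = Short m s
  ShortOutcome {ρ = ρ} m (return v)   = wordLength ρ v ≤ m

  Short-mono : ∀ {m n} → m ≤ n → {s : State Γ} → Short m s → Short n s
  Short-mono m≤n []       = []
  Short-mono m≤n (p ∷ ps) = ℕ.≤-trans p m≤n ∷ Short-mono m≤n ps

  Short-lookup : ∀ {m} {s : State Γ} → Short m s → (x : τ ∈ Γ) →
                 wordLength τ (All.lookup s x) ≤ m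
  Short-lookup (p ∷ _)  (here ≡.refl) = p
  Short-lookup (_ ∷ ps) (there x)     = Short-lookup ps x

  Short-update : ∀ {m} {s : State Γ} → Short m s → (x : τ ∈ Γ) → ∀ {v} →
                 wordLength τ v ≤ m → Short m (s All.[ x ]≔ v)
  Short-update (_ ∷ ps) (here ≡.refl) q = q ∷ ps
  Short-update (p ∷ ps) (there x)     q = p ∷ Short-update ps x q

  wordLength-default : ∀ τ {m} → wordLength τ (default τ) ≤ m
  wordLength-default word = z≤n
  wordLength-default num  = z≤n
  wordLength-default bool = z≤n

  Short-++⁺ : ∀ {m} {s : State Γ} {s′ : State Δ} → Short m s → Short m s′ →
              Short m (AllP.++⁺ s s′)
  Short-++⁺ []       qs = qs
  Short-++⁺ (p ∷ ps) qs = p ∷ Short-++⁺ ps qs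

  Short-initial : ∀ {m} (M : Algorithm 𝔽 Γ τ) {vs} → Short m vs → Short m (initial M vs)
  Short-initial M ps = Short-++⁺ ps (defaults (locals M))
    where
    defaults : ∀ {m} Δ → Short m (All.universal default Δ)
    defaults []      = []
    defaults (τ ∷ Δ) = wordLength-default τ ∷ defaults Δ

  length-tailWord : ∀ w → length (tailWord w) ≤ length w
  length-tailWord []      = z≤n
  length-tailWord (_ ∷ w) = ℕ.n≤1+n (length w)

  wordLength-⟦⟧ : ∀ {m} {s : State Γ} → Short m s → (e : Expr Γ τ) →
                  wordLength τ (⟦ e ⟧ s) ≤ m + cost e
  wordLength-⟦⟧ {m = m} short (var x) = ℕ.m≤n⇒m≤n+o 1 (Short-lookup short x)
  wordLength-⟦⟧ short nil             = z≤n
  wordLength-⟦⟧ {m = m} {s} short (cons e f) = begin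
    suc (length (⟦ f ⟧ s))       ≤⟨ s≤s (wordLength-⟦⟧ short f) ⟩
    suc (m + cost f)             ≡⟨ ℕ.+-suc m (cost f) ⟨
    m + suc (cost f)             ≤⟨ ℕ.+-monoʳ-≤ m (s≤s (ℕ.m≤n+m (cost f) (cost e))) ⟩
    m + suc (cost e + cost f)    ∎
    where open ℕ.≤-Reasoning
  wordLength-⟦⟧ {m = m} {s} short (tail e) = begin
    length (tailWord (⟦ e ⟧ s))  ≤⟨ length-tailWord (⟦ e ⟧ s) ⟩
    length (⟦ e ⟧ s)             ≤⟨ wordLength-⟦⟧ short e ⟩
    m + cost e                   ≤⟨ ℕ.+-monoʳ-≤ m (ℕ.n≤1+n (cost e)) ⟩
    m + suc (cost e)             ∎
    where open ℕ.≤-Reasoning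
  wordLength-⟦⟧ short (head e)        = z≤n
  wordLength-⟦⟧ short (null e)        = z≤n
  wordLength-⟦⟧ short (bit b)         = z≤n
  wordLength-⟦⟧ short (neg e)         = z≤n
  wordLength-⟦⟧ short (lit q)         = z≤n
  wordLength-⟦⟧ short (e ∔ f)         = z≤n
  wordLength-⟦⟧ short (e ∸ f)         = z≤n
  wordLength-⟦⟧ short (e ∙ f)         = z≤n
  wordLength-⟦⟧ short (e ⟋ f)         = z≤n
  wordLength-⟦⟧ short (ceil e)        = z≤n
  wordLength-⟦⟧ short (e ≼ f)         = z≤n

  Short-⟦⟧* : ∀ {m} {s : State Γ} → Short m s → (es : All (Expr Γ) Δ) →
              Short (m + cost* es) (⟦ es ⟧* s)
  Short-⟦⟧* short []       = []
  Short-⟦⟧* {m = m} short (e ∷ es) =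
    ℕ.≤-trans (wordLength-⟦⟧ short e) (ℕ.+-monoʳ-≤ m (ℕ.m≤m+n (cost e) (cost* es)))
    ∷ Short-mono (ℕ.+-monoʳ-≤ m (ℕ.m≤n+m (cost* es) (cost e))) (Short-⟦⟧* short es)

  private
    ≤-suc : ∀ {m} n {k} → k ≤ m + n → k ≤ m + suc n
    ≤-suc {m} n k≤ = ℕ.≤-trans k≤ (ℕ.+-monoʳ-≤ m (ℕ.n≤1+n n))

    assocʳ : ∀ m {a} n (o : Outcome Γ ρ) → ShortOutcome (m + a + n) o →
             ShortOutcome (m + (a + n)) o
    assocʳ m {a} n o = ≡.subst (λ k → ShortOutcome k o) (ℕ.+-assoc m a n)

    later : ∀ m {n} d (o : Outcome Γ ρ) → ShortOutcome (m + n) o → ShortOutcome (m + (d + n)) o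
    later m {n} d (continue s) short =
      Short-mono (ℕ.+-monoʳ-≤ m (ℕ.m≤n+m n d)) short
    later m {n} d (return v)   short = ℕ.≤-trans short (ℕ.+-monoʳ-≤ m (ℕ.m≤n+m n d))

    delayed : ∀ m d {t : Tree (Outcome Γ ρ)} → Always (λ n → ShortOutcome (m + n)) t →
              Always (λ n → ShortOutcome (m + n)) (delay d t)
    delayed m d short = Always-delay d (Always-map (λ {n} {o} → later m d o) short)

  -- A command lengthens words by at most one letter per unit of time, because
  -- evaluating an expression costs at least one unit for every letter it adds.
  mutual
    ⇓-Short : ∀ {c : Cmd Γ ρ} {s t m} → ⟨ c , s ⟩⇓ t → Short m s →
              Always (λ n → ShortOutcome (m + n)) t
    ⇓-Short {m = m} skip short = leaf (Short-mono (ℕ.m≤m+n m 1) short)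
    ⇓-Short {m = m} (assign {x = x} {e}) short =
      leaf (Short-update (Short-mono (ℕ.m≤m+n m _) short) x
        (≤-suc (cost e) (wordLength-⟦⟧ short e)))
    ⇓-Short {m = m} (toss-0 {x = x} _) short =
      leaf (Short-update (Short-mono (ℕ.m≤m+n m _) short) x z≤n)
    ⇓-Short {m = m} (toss-1 {x = x} _) short =
      leaf (Short-update (Short-mono (ℕ.m≤m+n m _) short) x z≤n)
    ⇓-Short {m = m} (toss {x = x} _ _) short = branch
      (leaf (Short-update (Short-mono (ℕ.m≤m+n m _) short) x z≤n))
      (leaf (Short-update (Short-mono (ℕ.m≤m+n m _) short) x z≤n))
    ⇓-Short {Γ = Γ} {ρ} {m = m} (call {s = s} {τ = τ} {x = x} {es = es} D) short =
      Always-delay (suc (cost* es)) (Always-mapTree⁺ {P = λ n → ShortOutcome (m + (suc (cost* es) + n))}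
        (Always-map (λ {n} {v} → update n v) (answer-Short D (Short-⟦⟧* short es))))
      where
      update : ∀ n v → wordLength τ v ≤ m + cost* es + n →
               Short (m + (suc (cost* es) + n)) (s All.[ x ]≔ v)
      update n v v≤ = Short-update (Short-mono (ℕ.m≤m+n m _) short) x
        (≤-suc (cost* es + n) (≡.subst (wordLength τ v ≤_) (ℕ.+-assoc m (cost* es) n) v≤))
    ⇓-Short (seq D G) short = Graft-Short G (⇓-Short D short)
    ⇓-Short {m = m} (if-true _ D) short = delayed m _ (⇓-Short D short)
    ⇓-Short {m = m} (if-false _ D) short = delayed m _ (⇓-Short D short)
    ⇓-Short {m = m} (while-true _ D) short = delayed m _ (⇓-Short D short)
    ⇓-Short {m = m} (while-false _) short = leaf (Short-mono (ℕ.m≤m+n m _) short)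
    ⇓-Short {m = m} (return {e = e}) short =
      leaf (≤-suc (cost e) (wordLength-⟦⟧ short e))

    Graft-Short : ∀ {d : Cmd Γ ρ} {t u m} → Graft (Then d) t u →
                  Always (λ n → ShortOutcome (m + n)) t →
                  Always (λ n → ShortOutcome (m + n)) u
    Graft-Short {m = m} (leaf {n = n} (Then.continue D)) (leaf short) =
      Always-delay n (Always-map (λ {k} {o} → assocʳ m k o) (⇓-Short D short))
    Graft-Short {ρ = ρ} {m = m} (leaf {n = n} (Then.return {v})) (leaf short) =
      leaf (≡.subst (λ k → wordLength ρ v ≤ m + k) (≡.sym (ℕ.+-identityʳ n)) short)
    Graft-Short (branch G H) (branch p q) = branch (Graft-Short G p) (Graft-Short H q)

    answer-Short : ∀ {M : Algorithm 𝔽 Γ τ} {vs t m} → M ⟨ vs ⟩⇓ t → Short m vs →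
                   Always (λ n v → wordLength τ v ≤ m + n) t
    answer-Short {M = M} {t = t} (run D) short =
      Always-mapTree⁻ t (⇓-Short D (Short-initial M short))

-- Repeated independent trials

module Repetition (𝔽 : ArchimedeanField) where
  open ArchimedeanField 𝔽 hiding (zero)
  open FieldProperties 𝔽
  open ≤-Reasoning
  open Solver commutativeSemiring using (solve)
    renaming (_:+_ to _⊕_; _:*_ to _⊗_; _:=_ to _⊜_)

  -- The probability that r independent trials do not all fail, where each
  -- trial succeeds with probability p and fails with probability q.
  hit : (p q : Carrier) → ℕ → Carrier
  hit p q zero    = 0#
  hit p q (suc r) = p + hit p q r * q

  module _ {p q : Carrier} (0≤p : 0# ≤ p) (0≤q : 0# ≤ q) (p+q≈1 : p + q ≈ 1#) where

    hit+q^r≈1 : ∀ r → hit p q r + q ^ r ≈ 1#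
    hit+q^r≈1 zero    = +-identityˡ 1#
    hit+q^r≈1 (suc r) = begin-equality
      p + hit p q r * q + q * q ^ r   ≈⟨ solve 4 (λ p q h w →
        p ⊕ h ⊗ q ⊕ q ⊗ w ⊜ p ⊕ (h ⊕ w) ⊗ q) refl p q (hit p q r) (q ^ r) ⟩
      p + (hit p q r + q ^ r) * q     ≈⟨ +-congˡ (*-congʳ (hit+q^r≈1 r)) ⟩
      p + 1# * q                      ≈⟨ +-congˡ (*-identityˡ q) ⟩
      p + q                           ≈⟨ p+q≈1 ⟩
      1#                              ∎

    -- As n p ≥ 3, Bernoulli's inequality gives q ^ n ≤ 1 / (1 + 3).
    ¾≤hit : ∀ n → fromℕ 3 ≤ fromℕ n * p → fromℕ 3 ÷ fromℕ 4 ≤ hit p q n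
    ¾≤hit n 3≤np = x≤z*y⇒x÷y≤z (0<fromℕ-suc 3) (+-cancelʳ-≤ (w * fromℕ 4) (begin
      fromℕ 3 + w * fromℕ 4               ≤⟨ +-monoʳ-≤ (fromℕ 3) 4w≤1 ⟩
      fromℕ 3 + 1#                        ≈⟨ +-comm _ _ ⟩
      fromℕ 4                             ≈⟨ *-identityˡ (fromℕ 4) ⟨
      1# * fromℕ 4                        ≈⟨ *-congʳ (hit+q^r≈1 n) ⟨
      (hit p q n + w) * fromℕ 4           ≈⟨ distribʳ (fromℕ 4) (hit p q n) w ⟩
      hit p q n * fromℕ 4 + w * fromℕ 4   ∎))
      where
      w = q ^ n
      4w≤1 : w * fromℕ 4 ≤ 1#
      4w≤1 = ≤-trans (*-monoʳ-≤ (0≤x^n n 0≤q) (+-monoʳ-≤ 1# 3≤np))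
                     (bernoulli 0≤p 0≤q p+q≈1 n)

  -- The number of rounds is ⌈ C / (ε / 2) ⌉, for any constant C between 3 and 5.
  -- The lower bound serves soundness, and the upper bound the running time.
  module _ {C ε : Carrier} (3≤C : fromℕ 3 ≤ C) (C≤5 : C ≤ fromℕ 5) (0<ε : 0# < ε) where
    private
      D : Carrier
      D = ε ÷ fromℕ 2

      0<2 : 0# < fromℕ 2
      0<2 = 0<fromℕ-suc 1

      0<D : 0# < D
      0<D = 0<x*y 0<ε (0<x⁻¹ 0<2)

      0<C : 0# < C
      0<C = begin-strict
        0#        <⟨ 0<fromℕ-suc 2 ⟩
        fromℕ 3   ≤⟨ 3≤C ⟩
        C         ∎

      D≤ε : D ≤ ε
      D≤ε = x≤z*y⇒x÷y≤z 0<2 (begin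
        ε             ≈⟨ *-identityʳ ε ⟨
        ε * 1#        ≤⟨ *-monoʳ-≤ (proj₁ 0<ε) (x≤x+y 1# (0≤fromℕ 1)) ⟩
        ε * fromℕ 2   ∎)

      C÷D≤ : C ÷ D ≤ fromℕ 10 * ε ⁻¹
      C÷D≤ = x≤z*y⇒x÷y≤z 0<D (begin
        C                                                ≤⟨ C≤5 ⟩
        fromℕ 5                                          ≈⟨ *-identityʳ _ ⟨
        fromℕ 5 * 1#                                     ≈⟨ *-congˡ (*-identityʳ 1#) ⟨
        fromℕ 5 * (1# * 1#)
          ≈⟨ *-congˡ (*-cong (x⁻¹-inverse 0<2) (x⁻¹-inverse 0<ε)) ⟨
        fromℕ 5 * (fromℕ 2 * fromℕ 2 ⁻¹ * (ε * ε ⁻¹))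
          ≈⟨ solve 5 (λ f t t′ e e′ → f ⊗ (t ⊗ t′ ⊗ (e ⊗ e′)) ⊜ f ⊗ t ⊗ e′ ⊗ (e ⊗ t′))
               refl (fromℕ 5) (fromℕ 2) (fromℕ 2 ⁻¹) ε (ε ⁻¹) ⟩
        fromℕ 5 * fromℕ 2 * ε ⁻¹ * (ε * fromℕ 2 ⁻¹)      ≈⟨ *-congʳ (*-congʳ (fromℕ-* 5 2)) ⟨
        fromℕ 10 * ε ⁻¹ * D                              ∎)

    iterations : ∃ λ n → ⌈ C ÷ (ε ÷ fromℕ 2) ⌉ ≡ ℤ.+ n × fromℕ 3 ≤ fromℕ n * ε ×
                         fromℕ n ≤ fromℕ 10 * ε ⁻¹ + fromℕ 1
    iterations with ⌈⌉-natural (0<x*y 0<C (0<x⁻¹ 0<D))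
    ... | n , ⌈⌉≡n = n , ⌈⌉≡n , lower , upper
      where
      ⌈⌉≈n : fromℤ ⌈ C ÷ D ⌉ ≡ fromℕ n
      ⌈⌉≈n = ≡.cong fromℤ ⌈⌉≡n
      lower : fromℕ 3 ≤ fromℕ n * ε
      lower = begin
        fromℕ 3                ≤⟨ 3≤C ⟩
        C                      ≈⟨ x÷y*y≈x 0<D ⟨
        C ÷ D * D              ≤⟨ *-monoˡ-≤ (proj₁ 0<D) (x≤⌈x⌉ (C ÷ D)) ⟩
        fromℤ ⌈ C ÷ D ⌉ * D    ≡⟨ ≡.cong (_* D) ⌈⌉≈n ⟩
        fromℕ n * D            ≤⟨ *-monoʳ-≤ (0≤fromℕ n) D≤ε ⟩
        fromℕ n * ε            ∎
      upper : fromℕ n ≤ fromℕ 10 * ε ⁻¹ + fromℕ 1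
      upper = begin
        fromℕ n                       ≡⟨ ⌈⌉≈n ⟨
        fromℤ ⌈ C ÷ D ⌉               ≤⟨ proj₁ (⌈x⌉<x+1 (C ÷ D)) ⟩
        C ÷ D + 1#                    ≈⟨ +-congˡ (+-identityʳ 1#) ⟨
        C ÷ D + fromℕ 1               ≤⟨ +-monoˡ-≤ _ _ (fromℕ 1) C÷D≤ ⟩
        fromℕ 10 * ε ⁻¹ + fromℕ 1     ∎

-- Rules for halting, running time, outcomes and expected values

module Executions (𝔽 : ArchimedeanField) where
  open ArchimedeanField 𝔽 hiding (zero)
  open FieldProperties 𝔽
  open Trees 𝔽
  open Randomized 𝔽 hiding
    ( FiniteDistribution; Algorithm; Samples; PolynomiallyDecides
    ; PolynomiallyComputesUnary; DomainsMatch; IsPRAX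
    ; Emptiness; Emptiness≤; Universality; Universality≥
    ; FinEmptiness; FinUniversality; c )
  open ≤-Reasoning

  private variable
    Γ Δ : Ctx
    τ ρ : Ty

  -- Exec c s P B f v: from the state s, the command c halts on every sequence of
  -- coin tosses, within time B and with an outcome that satisfies P, and the
  -- expected value of f at the outcome is at least v.
  record Exec (c : Cmd Γ ρ) (s : State Γ) (P : Outcome Γ ρ → Set) (B : Carrier)
              (f : Outcome Γ ρ → Carrier) (v : Carrier) : Set where
    constructor exec
    field
      {tree}  : Tree (Outcome Γ ρ)
      halts   : ⟨ c , s ⟩⇓ tree
      correct : Always (λ n o → fromℕ n ≤ B × P o) tree
      value   : v ≤ 𝔼 f tree

  private variable
    c d  : Cmd Γ ρ
    s s′ : State Γ
    P Q  : Outcome Γ ρ → Set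
    f g  : Outcome Γ ρ → Carrier
    B B′ v w : Carrier

  fromℕ-+-≤ : ∀ m {n} → fromℕ n ≤ B → fromℕ (m ℕ.+ n) ≤ fromℕ m + B
  fromℕ-+-≤ m n≤B = ≤-trans (≤-reflexive (fromℕ-+ m _)) (+-monoʳ-≤ (fromℕ m) n≤B)

  -- Time bounds may be raised and values lowered.
  exec-≤ : B ≤ B′ → w ≤ v → Exec c s P B f v → Exec c s P B′ f w
  exec-≤ B≤B′ w≤v (exec ⇓t Pt v≤) = exec ⇓t
    (Always-map (λ { (n≤B , p) → ≤-trans n≤B B≤B′ , p }) Pt) (≤-trans w≤v v≤)

  exec-assign : ∀ {x : τ ∈ Γ} {e} → P (continue (s All.[ x ]≔ ⟦ e ⟧ s)) →
                v ≤ f (continue (s All.[ x ]≔ ⟦ e ⟧ s)) →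
                Exec (x ≔ e) s P (fromℕ (1 ℕ.+ cost e)) f v
  exec-assign p v≤ = exec assign (leaf (≤-refl , p)) v≤

  exec-skip : P (continue s) → v ≤ f (continue s) → Exec skip s P (fromℕ 1) f v
  exec-skip p v≤ = exec skip (leaf (≤-refl , p)) v≤

  exec-return : ∀ {e} → P (return (⟦ e ⟧ s)) → v ≤ f (return (⟦ e ⟧ s)) →
                Exec (return e) s P (fromℕ (1 ℕ.+ cost e)) f v
  exec-return p v≤ = exec return (leaf (≤-refl , p)) v≤

  exec-call : ∀ {x : τ ∈ Γ} {M : Algorithm 𝔽 Δ τ} {es t} → M ⟨ ⟦ es ⟧* s ⟩⇓ t →
              Always (λ n a → fromℕ n ≤ B × P (continue (s All.[ x ]≔ a))) t →
              v ≤ 𝔼 (λ a → f (continue (s All.[ x ]≔ a))) t →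
              Exec (x ≔call M ⟨ es ⟩) s P (fromℕ (1 ℕ.+ cost* es) + B) f v
  exec-call {s = s} {B} {v = v} {f = f} {x = x} {es = es} {t} M⇓t Pt v≤ = exec (call M⇓t)
    (Always-delay (1 ℕ.+ cost* es) (Always-mapTree⁺ (Always-map
      (λ { (n≤B , p) → fromℕ-+-≤ (1 ℕ.+ cost* es) n≤B , p }) Pt)))
    (begin
      v                                       ≤⟨ v≤ ⟩
      𝔼 (λ a → f (result a)) t                ≡⟨ 𝔼-mapTree f result t ⟨
      𝔼 f (mapTree result t)                  ≡⟨ 𝔼-delay f (1 ℕ.+ cost* es) (mapTree result t) ⟨
      𝔼 f (delay (1 ℕ.+ cost* es) (mapTree result t)) ∎)
    where
    result : _ → Outcome _ _
    result a = continue (s All.[ x ]≔ a)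

  exec-delay : ∀ n {t} → ⟨ c , s ⟩⇓ delay n t →
               Always (λ n o → fromℕ n ≤ B × P o) t → v ≤ 𝔼 f t →
               Exec c s P (fromℕ n + B) f v
  exec-delay {f = f} n {t} ⇓t Pt v≤ = exec ⇓t
    (Always-delay n (Always-map (λ { (m≤B , p) → fromℕ-+-≤ n m≤B , p }) Pt))
    (≤-trans v≤ (≤-reflexive (reflexive (≡.sym (𝔼-delay f n t)))))

  exec-if-true : ∀ {e} → ⟦ e ⟧ s ≡ true → Exec c s P B f v →
                 Exec (ifThenElse e c d) s P (fromℕ (1 ℕ.+ cost e) + B) f v
  exec-if-true e≡ (exec ⇓t Pt v≤) = exec-delay _ (if-true e≡ ⇓t) Pt v≤

  exec-if-false : ∀ {e} → ⟦ e ⟧ s ≡ false → Exec d s P B f v →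
                  Exec (ifThenElse e c d) s P (fromℕ (1 ℕ.+ cost e) + B) f v
  exec-if-false e≡ (exec ⇓t Pt v≤) = exec-delay _ (if-false e≡ ⇓t) Pt v≤

  exec-while-true : ∀ {e} → ⟦ e ⟧ s ≡ true → Exec (c ⨾ while e c) s P B f v →
                    Exec (while e c) s P (fromℕ (1 ℕ.+ cost e) + B) f v
  exec-while-true e≡ (exec ⇓t Pt v≤) = exec-delay _ (while-true e≡ ⇓t) Pt v≤

  exec-while-false : ∀ {e} → ⟦ e ⟧ s ≡ false → P (continue s) → v ≤ f (continue s) →
                     Exec (while e c) s P (fromℕ (1 ℕ.+ cost e)) f v
  exec-while-false e≡ p v≤ = exec (while-false e≡) (leaf (≤-refl , p)) v≤

  -- The intermediate function g has as its value at a state s′ the value that d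
  -- guarantees from s′.  If c returns, then d is skipped.
  exec-seq : 0# ≤ B′ → Exec c s Q B g v →
             (∀ {s′} → Q (continue s′) → Exec d s′ P B′ f (g (continue s′))) →
             (∀ {a} → Q (return a) → P (return a) × g (return a) ≤ f (return a)) →
             Exec (c ⨾ d) s P (B + B′) f v
  exec-seq {B′ = B′} {Q = Q} {B = B} {g} {d = d} {P = P} {f} 0≤B′ (exec ⇓t Qt v≤) next stop
    with graft {R = Then d} {Q = λ n o → fromℕ n ≤ B + B′ × P o} {g} {f} Qt (λ {n} {o} → continuation n o)
    where
    continuation : ∀ n o → fromℕ n ≤ B × Q o → ∃ λ u →
      Then d o u × Always (λ m o → fromℕ (n ℕ.+ m) ≤ B + B′ × P o) u × g o ≤ 𝔼 f u
    continuation n (continue s′) (n≤B , q) with next q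
    ... | exec ⇓u Pu g≤ = _ , continue ⇓u ,
      Always-map (λ {m} → λ { (m≤B′ , p) →
        ≤-trans (≤-reflexive (fromℕ-+ n m)) (+-mono-≤ n≤B m≤B′) , p }) Pu , g≤
    continuation n (return a) (n≤B , q) = _ , return , leaf
      (≤-trans (≤-reflexive (fromℕ-+ n 0)) (+-mono-≤ n≤B 0≤B′) , proj₁ (stop q)) ,
      proj₂ (stop q)
  ... | u , G , Pu , g≤ = exec (seq ⇓t G) Pu (≤-trans v≤ g≤)

  -- The first command is deterministic, with final state s′.
  exec-then : 0# ≤ B′ → Exec c s (_≡ continue s′) B (λ _ → v) v → Exec d s′ P B′ f v →
              Exec (c ⨾ d) s P (B + B′) f v
  exec-then 0≤B′ first second = exec-seq 0≤B′ first (λ { ≡.refl → second }) (λ ())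

  -- If the body of an algorithm always returns, then the algorithm halts with a
  -- tree of answers.
  answers : ∀ {M : Algorithm 𝔽 Γ τ} {vs} {P : Outcome (Γ List.++ locals M) τ → Set}
              {R : ⟦ τ ⟧ᵗ → Set} {f} →
            Exec (body M) (initial M vs) P B f v →
            (∀ {s} → ¬ P (continue s)) → (∀ {a} → P (return a) → R a) →
            ∃ λ t → (M ⟨ vs ⟩⇓ t) × Always (λ n a → R a × fromℕ n ≤ B) t ×
                    v ≤ 𝔼 (λ a → f (return a)) t
  answers {B = B} {P = P} {f = f} (exec {tree} ⇓tree correct v≤) stops P⇒R
    with returned correct
    where
    returned : ∀ {u} → Always (λ n o → fromℕ n ≤ B × P o) u → ∃ λ t → mapTree return t ≡ u
    returned (leaf {n} {continue _} (_ , p)) = contradiction p stops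
    returned (leaf {n} {return a} _)         = leaf n a , ≡.refl
    returned (branch {p} {p>0} {p<1} Ph Pt) with returned Ph | returned Pt
    ... | h , ≡.refl | t , ≡.refl = branch p p>0 p<1 h t , ≡.refl
  ... | t , ≡.refl = t , run ⇓tree ,
    Always-map (λ { (n≤B , p) → P⇒R p , n≤B }) (Always-mapTree⁻ t correct) ,
    ≤-trans v≤ (≤-reflexive (reflexive (𝔼-mapTree f return t)))

-- Random search for an element of a decidable set

-- The common part of both algorithms: a search for a sampled object in Q α,
-- where test computes membership in Q α from the variable b, which holds the
-- answer of the decision procedure for 𝓛 α.
module Search
  (𝔽 : ArchimedeanField) {Object : Set} (objects : Coding Object)
  (T : ℕ → FiniteDistribution 𝔽 Object)
  (SelectFinFam : Algorithm 𝔽 (word ∷ []) word)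
  (samples : Samples 𝔽 objects T SelectFinFam)
  (Π : Problem Object)
  (decide : Algorithm 𝔽 (word ∷ word ∷ []) bool)
  (decides : PolynomiallyDecides 𝔽 objects Π decide)
  (index : Problem.Instance Π → ℕ)
  (match : DomainsMatch 𝔽 Π T index)
  (distrParameter : Algorithm 𝔽 (word ∷ []) word)
  (computes : PolynomiallyComputesUnary 𝔽 Π index distrParameter)
  (Q : Problem.Instance Π → Pred Object 0ℓ) (Q? : ∀ α → Decidable (Q α))
  (test : Randomized.Expr 𝔽 (Randomized.SearchVariables.vars 𝔽) bool)
  (test-Q? : ∀ α x s →
    All.lookup s (Randomized.SearchVariables.b 𝔽) ≡ does (Problem.𝓛? Π α x) →
    Randomized.⟦_⟧ 𝔽 test s ≡ does (Q? α x))
  where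

  open ArchimedeanField 𝔽 hiding (zero)
  open FieldProperties 𝔽 hiding (total)
  open Trees 𝔽
  open Polynomials 𝔽
  open WordLengths 𝔽 hiding ([]; _∷_)
  open Executions 𝔽
  open Repetition 𝔽
  open Distributions 𝔽 objects
  open Randomized 𝔽 hiding
    ( FiniteDistribution; Algorithm; Samples; PolynomiallyDecides
    ; PolynomiallyComputesUnary; DomainsMatch; IsPRAX
    ; Emptiness; Emptiness≤; Universality; Universality≥
    ; FinEmptiness; FinUniversality; c )
  open Problem Π
  open ≤-Reasoning
  open Solver commutativeSemiring using (solve)
    renaming (_:+_ to _⊕_; _:*_ to _⊗_; _:=_ to _⊜_; con to κ)
  module V = SearchVariables
  private
    module Obj  = Coding objects
    module Inst = Coding instances
    module Dist α = FiniteDistribution (T (index α))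

  -- The body of the loop: one sample and its test.
  roundBody : Cmd V.vars bool
  roundBody =
    V.i ≔ var V.i ∔ lit 1# ⨾
    V.x ≔call SelectFinFam ⟨ var V.k ∷ [] ⟩ ⨾
    V.b ≔call decide ⟨ var V.α ∷ var V.x ∷ [] ⟩ ⨾
    ifThenElse test (return (bit false)) skip

  -- The search with an arbitrary constant C in place of c.  Only the bounds
  -- 3 ≤ C ≤ 5 matter.
  searchBody : Carrier → Cmd V.vars bool
  searchBody C =
    V.k ≔call distrParameter ⟨ var V.α ∷ [] ⟩ ⨾
    V.n ≔ ceil (lit C ⟋ (var V.ε ⟋ lit (fromℕ 2))) ⨾
    V.i ≔ lit 0# ⨾
    while (neg (var V.n ≼ var V.i)) roundBody ⨾
    return (bit true)

  searchWith : Carrier → Algorithm 𝔽 (word ∷ num ∷ []) bool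
  searchWith C = algorithm (word ∷ word ∷ num ∷ num ∷ bool ∷ []) (searchBody C)

  c : Carrier
  c = Randomized.c 𝔽 SelectFinFam decide distrParameter

  -- Bounds in terms of the size of α: on the times of the three given algorithms,
  -- on index α and on the sizes of sampled objects.  A length is bounded by the
  -- length of the input plus the running time.
  indexTime indexLength selectTime objectLength decideTime : Poly 1
  indexTime    = proj₁ computes
  indexLength  = var zero :+ indexTime
  selectTime   = proj₁ samples [ indexLength ∷ [] ]
  objectLength = indexLength :+ selectTime
  decideTime   = proj₁ decides [ var zero ∷ objectLength ∷ [] ]

  -- Bounds on the times of the final segments of a round: the test (its longer
  -- branch takes time 2), the decision followed by it, the sampling followed by
  -- these, the whole body, and the body together with the evaluation of the guard.
  -- The other constants are the costs of passing arguments (2 and 3), of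
  -- increasing the counter (4) and of evaluating the guard (5).
  testTime checkTime trialTime bodyTime roundTime : Poly 1
  testTime  = con (1 ℕ.+ cost test) :+ con 2
  checkTime = (con 3 :+ decideTime) :+ testTime
  trialTime = (con 2 :+ selectTime) :+ checkTime
  bodyTime  = con 4 :+ trialTime
  roundTime = con 5 :+ bodyTime

  -- The variables are 1/ε and the size of α; the number of rounds is at most
  -- 10/ε + 1, and the guard is evaluated once more at the end.  The assignments
  -- of n and i cost 7 and 2.
  searchTime : Poly 2
  searchTime = (con 2 :+ (indexTime [ var (suc zero) ∷ [] ])) :+ (con 7 :+ (con 2 :+
    (((((con 10 :* var zero) :+ con 1) :* (roundTime [ var (suc zero) ∷ [] ]))
      :+ con 5) :+ con 2)))

  module _ (α : Instance) where

    size : Carrier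
    size = fromℕ (Inst.size α)

    0≤size : 0# ≤ size
    0≤size = 0≤fromℕ (Inst.size α)

    -- The value of a bound at the size of α.
    time : Poly 1 → Carrier
    time p = evalPoly p (size ∷ [])

    0≤time : ∀ p → 0# ≤ time p
    0≤time p = proj₁ (evalPoly-0≤≤ p ((0≤size , ≤-refl) ∷ []))

    -- A bound on the running time of a search with n rounds.
    totalTime : Carrier → Carrier
    totalTime n = (fromℕ 2 + time indexTime) + (fromℕ 7 + (fromℕ 2 +
                  ((n * time roundTime + fromℕ 5) + fromℕ 2)))

    computation : ∃ λ t → (distrParameter ⟨ Inst.code α ∷ [] ⟩⇓ t) ×
      Always (λ n w → w ≡ unary (index α) × n Within time indexTime) t
    computation = proj₂ computes α

    -- The computation of index α takes time at most indexTime, and its answer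
    -- consists of index α letters.
    index≤ : fromℕ (index α) ≤ time indexLength
    index≤ with computation
    ... | t , ⇓t , correct with Always-satisfiable (Always-zip correct
                                  (answer-Short ⇓t (ℕ.≤-refl Short.∷ Short.[])))
    ...   | n , _ , (≡.refl , n≤) , short = begin
      fromℕ (index α)                   ≡⟨ ≡.cong fromℕ (List.length-replicate (index α)) ⟨
      fromℕ (length (unary (index α)))  ≤⟨ fromℕ-mono-≤ short ⟩
      fromℕ (Inst.size α ℕ.+ n)         ≤⟨ fromℕ-+-≤ (Inst.size α) n≤ ⟩
      time indexLength                  ∎

    -- Every outcome of the sampler is the code of an object in the support, and a
    -- bound on its length follows from the running time.
    sampling : ∃ λ t → (SelectFinFam ⟨ unary (index α) ∷ [] ⟩⇓ t) ×
      (∀ x → Pr[ t ≡ʷ Obj.code x ] ≈ Dist.mass α x) ×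
      Always (λ n w → fromℕ n ≤ time selectTime ×
        ∃ λ x → x ∈ Dist.support α × w ≡ Obj.code x × fromℕ (Obj.size x) ≤ time objectLength) t
    sampling with proj₂ samples (index α)
    ... | t , ⇓t , masses , timely = t , ⇓t , masses , Always-map
      (λ { {n} ((n≤ , x , x∈ , ≡.refl) , short) → n≤selectTime {n} n≤ , x , x∈ , ≡.refl , (begin
        fromℕ (Obj.size x)                            ≤⟨ fromℕ-mono-≤ short ⟩
        fromℕ (length (unary (index α)) ℕ.+ n)
          ≡⟨ ≡.cong (λ k → fromℕ (k ℕ.+ n)) (List.length-replicate (index α)) ⟩
        fromℕ (index α ℕ.+ n)                         ≤⟨ fromℕ-+-≤ (index α) (n≤selectTime {n} n≤) ⟩
        fromℕ (index α) + time selectTime             ≤⟨ +-monoˡ-≤ _ _ _ index≤ ⟩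
        time objectLength                             ∎) })
      (Always-zip (Always-zip timely (Sampling.sample∈support (T (index α)) {t} masses))
                  (answer-Short ⇓t (ℕ.≤-refl Short.∷ Short.[])))
      where
      n≤selectTime : ∀ {n} → fromℕ n ≤ evalPoly (proj₁ samples) (fromℕ (index α) ∷ []) →
                     fromℕ n ≤ time selectTime
      n≤selectTime {n} n≤ = begin
        fromℕ n   ≤⟨ n≤ ⟩
        evalPoly (proj₁ samples) (fromℕ (index α) ∷ [])
          ≤⟨ evalPoly-mono (proj₁ samples) ((0≤fromℕ (index α) , index≤) ∷ []) ⟩
        evalPoly (proj₁ samples) (time indexLength ∷ [])
          ≡⟨ evalPoly-[] (proj₁ samples) (indexLength ∷ []) (size ∷ []) ⟨
        time selectTime ∎

    -- Objects in the support lie in X α, where the decision procedure is known to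
    -- halt.
    decision : ∀ {x} → x ∈ Dist.support α → fromℕ (Obj.size x) ≤ time objectLength →
      ∃ λ t → (decide ⟨ Inst.code α ∷ Obj.code x ∷ [] ⟩⇓ t) ×
      Always (λ n b → b ≡ does (𝓛? α x) × fromℕ n ≤ time decideTime) t
    decision {x} x∈ |x|≤ with proj₂ decides α x
                       (proj₂ (match α) (Equivalence.to (Dist.support-dom α x) x∈))
    ... | t , ⇓t , correct = t , ⇓t , Always-map (λ { {n} (b≡ , n≤) → b≡ , (begin
      fromℕ n   ≤⟨ n≤ ⟩
      evalPoly (proj₁ decides) (size ∷ fromℕ (Obj.size x) ∷ [])
        ≤⟨ evalPoly-mono (proj₁ decides)
             ((0≤size , ≤-refl) ∷ (0≤fromℕ (Obj.size x) , |x|≤) ∷ []) ⟩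
      evalPoly (proj₁ decides) (size ∷ time objectLength ∷ [])
        ≡⟨ evalPoly-[] (proj₁ decides) (var zero ∷ objectLength ∷ []) (size ∷ []) ⟨
      time decideTime ∎) }) correct

    Q̄? : Decidable (λ x → ¬ Q α x)
    Q̄? x = ¬? (Q? α x)

    -- The probabilities that one round succeeds and fails.
    p q : Carrier
    p = Dist.massOf α (Q? α)
    q = Dist.massOf α Q̄?

    -- Some object that can be sampled satisfies Q.
    Hit : Set
    Hit = ∃ λ x → x ∈ Dist.support α × Q α x

    module _ (ε : Carrier) (N : ℕ) where

      -- The states of the loop, with sampled word x, counter i and decision b.
      state : Word → Carrier → Bool → State V.vars
      state x i b =
        Inst.code α ∷ ε ∷ unary (index α) ∷ x ∷ fromℕ N ∷ i ∷ b ∷ []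

      -- A round answers only false, and only after a hit.
      Found : Bool → Set
      Found b = b ≡ false × Hit

      -- The expected value of onFalse is the probability of the answer false.
      onFalse : Bool → Carrier
      onFalse b = 𝟙 (does (b Bool.≟ false))

      -- The outcomes of a round that starts with counter i.
      AfterBody : Carrier → Outcome V.vars bool → Set
      AfterBody i (continue s) = ∃ λ x → ∃ λ b → s ≡ state x (i + 1#) b
      AfterBody i (return b)   = Found b

      -- The value of an outcome, where a computation that goes on is worth y.
      valueOr : Carrier → Outcome V.vars bool → Carrier
      valueOr y (continue _) = y
      valueOr y (return b)   = onFalse b

      -- The outcomes of the call of the sampler, with counter i.
      Sampled : Carrier → Outcome V.vars bool → Set
      Sampled i (continue s) = ∃ λ x → ∃ λ b → x ∈ Dist.support α ×
        fromℕ (Obj.size x) ≤ time objectLength × s ≡ state (Obj.code x) i b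
      Sampled i (return _)   = ⊥

      -- The value of a sampled word: 1 if it encodes an object in Q, and y if it
      -- encodes another object of the support.  As a combination of indicators, it
      -- has expected value p + y q.
      sampleValue : Carrier → Word → Carrier
      sampleValue y w = 𝟙 (isCodeIn (filter (Q? α) (Dist.support α)) w)
                      + y * 𝟙 (isCodeIn (filter Q̄? (Dist.support α)) w)

      sampleValue-code : ∀ y {x} → x ∈ Dist.support α →
        sampleValue y (Obj.code x) ≈ (if does (Q? α x) then 1# else y)
      sampleValue-code y {x} x∈ with isCodeIn-filter (Q? α) x∈ | isCodeIn-filter Q̄? x∈
      ... | in-Q | in-Q̄ rewrite in-Q | in-Q̄ with does (Q? α x)
      ...   | true  = trans (+-congˡ (zeroʳ y)) (+-identityʳ 1#)
      ...   | false = trans (+-congˡ (*-identityʳ y)) (+-identityˡ y)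

      exec-test : ∀ {x i b y} → x ∈ Dist.support α → b ≡ does (𝓛? α x) →
        Exec (ifThenElse test (return (bit false)) skip) (state (Obj.code x) (i + 1#) b)
             (AfterBody i) (time testTime)
             (valueOr y) (if does (Q? α x) then 1# else y)
      exec-test {x} {i} {b} {y} x∈ b≡
        with Q? α x | test-Q? α x (state (Obj.code x) (i + 1#) b) b≡
      ... | yes Qx | test≡ = exec-if-true test≡ (exec-return (≡.refl , x , x∈ , Qx) ≤-refl)
      ... | no ¬Qx | test≡ = exec-if-false test≡
        (exec-≤ (fromℕ-mono-≤ {1} {2} (ℕ.s≤s ℕ.z≤n)) ≤-refl (exec-skip (_ , _ , ≡.refl) ≤-refl))

      exec-body : ∀ {x i b y} →
        Exec roundBody (state x i b) (AfterBody i) (time bodyTime) (valueOr y) (p + y * q)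
      exec-body {x} {i} {b} {y} with sampling
      ... | t , ⇓t , masses , correct =
        exec-then (0≤time trialTime) (exec-assign ≡.refl ≤-refl)
        (exec-seq {Q = Sampled (i + 1#)} {g = valueOfSample} (0≤time checkTime)
          (exec-call ⇓t
            (Always-map (λ { (n≤ , x , x∈ , ≡.refl , |x|≤) → n≤ , x , _ , x∈ , |x|≤ , ≡.refl }) correct)
            (≤-reflexive (sym expectation)))
          (λ { (x , _ , x∈ , |x|≤ , ≡.refl) → after-sample x∈ |x|≤ })
          (λ ()))
        where
        open Sampling (T (index α)) {t} masses
        -- A call never returns from the search, so that the second value is
        -- irrelevant.
        valueOfSample : Outcome V.vars bool → Carrier
        valueOfSample (continue s) = sampleValue y (All.lookup s V.x)
        valueOfSample (return _)   = 0#
        expectation : 𝔼 (sampleValue y) t ≈ p + y * q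
        expectation = begin-equality
          𝔼 (sampleValue y) t   ≈⟨ 𝔼-+ _ _ t ⟩
          _ + _                 ≈⟨ +-cong (reflexive (≡.sym (Pr≡𝔼 _ t)))
                                     (trans (𝔼-* y _ t) (*-congˡ (reflexive (≡.sym (Pr≡𝔼 _ t))))) ⟩
          Pr _ t + y * Pr _ t   ≈⟨ +-cong (Pr-sample∈ (Q? α)) (*-congˡ (Pr-sample∈ Q̄?)) ⟩
          p + y * q             ∎
        after-sample : ∀ {x b} → x ∈ Dist.support α → fromℕ (Obj.size x) ≤ time objectLength →
          Exec (V.b ≔call decide ⟨ var V.α ∷ var V.x ∷ [] ⟩ ⨾
                ifThenElse test (return (bit false)) skip)
            (state (Obj.code x) (i + 1#) b) (AfterBody i)
            (time checkTime)
            (valueOr y) (sampleValue y (Obj.code x))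
        after-sample {x} x∈ |x|≤ with decision x∈ |x|≤
        ... | u , ⇓u , b≡ = exec-then (0≤time testTime)
          (exec-call ⇓u (Always-map (λ { (≡.refl , n≤) → n≤ , ≡.refl }) b≡)
            (≤-reflexive (sym (𝔼-const _ u))))
          (exec-≤ ≤-refl (≤-reflexive (sampleValue-code y x∈)) (exec-test x∈ ≡.refl))

      -- The outcomes of the loop.
      Searching : Outcome V.vars bool → Set
      Searching (continue _) = ⊤
      Searching (return b)   = Found b

      -- The loop with counter j has r = N - j rounds left.  The counter is only
      -- equivalent to j, as scalars carry a setoid equality.  A round that finds
      -- nothing leaves a loop of value hit p q (r - 1).
      exec-loop : ∀ r {j x i b} → i ≈ fromℕ j → j ℕ.+ r ≡ N →
        Exec (while (neg (var V.n ≼ var V.i)) roundBody) (state x i b) Searching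
             (fromℕ r * time roundTime + fromℕ 5) (valueOr 0#) (hit p q r)
      exec-loop zero {j} {x} {i} {b} i≈j j≡N = exec-≤ (≤-reflexive bound) ≤-refl
        (exec-while-false (≡.cong not (dec-true (fromℕ N ≤? i) N≤i)) tt ≤-refl)
        where
        bound : fromℕ 5 ≈ 0# * time roundTime + fromℕ 5
        bound = sym (trans (+-congʳ (zeroˡ _)) (+-identityˡ _))
        N≤i : fromℕ N ≤ i
        N≤i = ≤-reflexive (trans
          (reflexive (≡.cong fromℕ (≡.trans (≡.sym j≡N) (ℕ.+-identityʳ j)))) (sym i≈j))
      exec-loop (suc r) {j} {x} {i} {b} i≈j j+r≡N = exec-≤ (≤-reflexive bound) ≤-refl
        (exec-while-true (≡.cong not (dec-false (fromℕ N ≤? i) N≰i))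
          (exec-seq {Q = AfterBody i} {g = valueOr (hit p q r)} 0≤rest exec-body
            (λ { (x , b , ≡.refl) → exec-loop r i+1≈
                   (≡.trans (≡.sym (ℕ.+-suc j r)) j+r≡N) })
            (λ found → found , ≤-refl)))
        where
        bound : fromℕ 5 + (time bodyTime + (fromℕ r * time roundTime + fromℕ 5)) ≈
                fromℕ (suc r) * time roundTime + fromℕ 5
        bound = solve 3 (λ f b r → f ⊕ (b ⊕ (r ⊗ (f ⊕ b) ⊕ f)) ⊜ (κ 1 ⊕ r) ⊗ (f ⊕ b) ⊕ f)
          refl (fromℕ 5) (time bodyTime) (fromℕ r)
        0≤rest : 0# ≤ fromℕ r * time roundTime + fromℕ 5
        0≤rest = +-nonNegative (*-nonNegative _ _ (0≤fromℕ r) (0≤time roundTime)) (0≤fromℕ 5)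
        i+1≈ : i + 1# ≈ fromℕ (suc j)
        i+1≈ = trans (+-congʳ i≈j) (+-comm _ _)
        N≰i : ¬ fromℕ N ≤ i
        N≰i N≤i = <⇒≱ (fromℕ-mono-< {j} {N} (≡.subst (j ℕ.<_) j+r≡N (ℕ.m<m+n j (ℕ.s≤s ℕ.z≤n))))
          (≤-trans N≤i (≤-reflexive i≈j))

      -- The outcomes of the whole search.
      Searched : Outcome V.vars bool → Set
      Searched (continue _) = ⊥
      Searched (return b)   = b ≡ true ⊎ Hit

      exec-search : ∀ {C} → fromℤ ⌈ C ÷ (ε ÷ fromℕ 2) ⌉ ≡ fromℕ N →
        Exec (searchBody C) (Inst.code α ∷ ε ∷ [] ∷ [] ∷ 0# ∷ 0# ∷ false ∷ []) Searched
             (totalTime (fromℕ N)) (valueOr 0#) (hit p q N)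
      exec-search ⌈⌉≡N with computation
      ... | t , ⇓t , correct =
        exec-then (+-nonNegative (0≤fromℕ 7) 0≤afterN)
          (exec-call ⇓t (Always-map (λ { (≡.refl , n≤) → n≤ , ≡.refl }) correct)
            (≤-reflexive (sym (𝔼-const _ t))))
        (exec-then 0≤afterN
          (exec-assign (≡.cong (λ n → continue
            (Inst.code α ∷ ε ∷ unary (index α) ∷ [] ∷ n ∷ 0# ∷ false ∷ [])) ⌈⌉≡N) ≤-refl)
        (exec-then 0≤loop (exec-assign ≡.refl ≤-refl)
        (exec-seq {Q = Searching} {g = valueOr 0#} (0≤fromℕ 2) (exec-loop N {0} refl ≡.refl)
          (λ _ → exec-return (inj₁ ≡.refl) ≤-refl)
          (λ { (_ , hit) → inj₂ hit , ≤-refl }))))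
        where
        0≤loop : 0# ≤ (fromℕ N * time roundTime + fromℕ 5) + fromℕ 2
        0≤loop = +-nonNegative (+-nonNegative
          (*-nonNegative _ _ (0≤fromℕ N) (0≤time roundTime)) (0≤fromℕ 5)) (0≤fromℕ 2)
        0≤afterN : 0# ≤ fromℕ 2 + ((fromℕ N * time roundTime + fromℕ 5) + fromℕ 2)
        0≤afterN = +-nonNegative (0≤fromℕ 2) 0≤loop

  searchTime-bound : ∀ α {n} ε → n ≤ fromℕ 10 * ε ⁻¹ + fromℕ 1 →
                     totalTime α n ≤ evalPoly searchTime (ε ⁻¹ ∷ size α ∷ [])
  searchTime-bound α ε n≤ = +-mono-≤
    (+-monoʳ-≤ (fromℕ 2) (≤-reflexive (in-size indexTime)))
    (+-monoʳ-≤ (fromℕ 7) (+-monoʳ-≤ (fromℕ 2) (+-monoˡ-≤ _ _ (fromℕ 2) (+-monoˡ-≤ _ _ (fromℕ 5)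
      (≤-trans (*-monoˡ-≤ (0≤time α roundTime) n≤) (≤-reflexive (*-congˡ (in-size roundTime))))))))
    where
    in-size : ∀ r → time α r ≈ evalPoly (r [ var (suc zero) ∷ [] ]) (ε ⁻¹ ∷ size α ∷ [])
    in-size r = reflexive (≡.sym (evalPoly-[] r (var (suc zero) ∷ []) (ε ⁻¹ ∷ size α ∷ [])))

  module _ {C : Carrier} (3≤C : fromℕ 3 ≤ C) (C≤5 : C ≤ fromℕ 5) where

    -- What a PRAX algorithm requires of the tree t on input α and ε.
    Correct : Instance → Carrier → Tree Bool → Set
    Correct α ε t =
      (searchWith C ⟨ Inst.code α ∷ ε ∷ [] ⟩⇓ t) ×
      (p α ≈ 0# → Always (λ _ b → b ≡ true) t) ×
      (¬ p α ≤ ε → fromℕ 3 ÷ fromℕ 4 ≤ Pr[ t ≡ᵇ false ]) ×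
      Always (λ n _ → n Within evalPoly searchTime (ε ⁻¹ ∷ size α ∷ [])) t

    correct : ∀ α {ε} N → fromℕ 3 ≤ fromℕ N * ε →
      fromℕ N ≤ fromℕ 10 * ε ⁻¹ + fromℕ 1 → ∀ {t} →
      (searchWith C ⟨ Inst.code α ∷ ε ∷ [] ⟩⇓ t) →
      Always (λ n b → (b ≡ true ⊎ Hit α) × fromℕ n ≤ totalTime α (fromℕ N)) t →
      hit (p α) (q α) N ≤ 𝔼 (λ b → 𝟙 (does (b Bool.≟ false))) t →
      Correct α ε t
    correct α {ε} N 3≤Nε N≤ {t} ⇓t answer hit≤ = ⇓t , complete , sound , timely
      where
      complete : p α ≈ 0# → Always (λ _ b → b ≡ true) t
      complete p≈0 = Always-map (λ
        { (inj₁ b≡true , _)        → b≡true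
        ; (inj₂ (x , x∈ , Qx) , _) →
            contradiction Qx (Masses.massOf≈0⇒disjoint 𝔽 (T (index α)) (Q? α) p≈0 x∈) }) answer
      sound : ¬ p α ≤ ε → fromℕ 3 ÷ fromℕ 4 ≤ Pr[ t ≡ᵇ false ]
      sound p≰ε = begin
        fromℕ 3 ÷ fromℕ 4                          ≤⟨ ¾≤hit
          (Masses.0≤massOf 𝔽 (T (index α)) (Q? α)) (Masses.0≤massOf 𝔽 (T (index α)) (Q̄? α))
          (Masses.massOf-complement 𝔽 (T (index α)) (Q? α)) N
          (≤-trans 3≤Nε (*-monoʳ-≤ (0≤fromℕ N) (proj₁ (≰⇒> p≰ε)))) ⟩
        hit (p α) (q α) N                          ≤⟨ hit≤ ⟩
        𝔼 (λ b → 𝟙 (does (b Bool.≟ false))) t      ≡⟨ Pr≡𝔼 (λ b → does (b Bool.≟ false)) t ⟨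
        Pr[ t ≡ᵇ false ]                           ∎
      timely : Always (λ n _ → n Within evalPoly searchTime (ε ⁻¹ ∷ size α ∷ [])) t
      timely = Always-map (λ { (_ , n≤) → ≤-trans n≤ (searchTime-bound α ε N≤) }) answer

    searchWith-halts : ∀ α {ε} → (∃ λ N → ⌈ C ÷ (ε ÷ fromℕ 2) ⌉ ≡ ℤ.+ N ×
      fromℕ 3 ≤ fromℕ N * ε × fromℕ N ≤ fromℕ 10 * ε ⁻¹ + fromℕ 1) → ∃ (Correct α ε)
    searchWith-halts α {ε} (N , ⌈⌉≡N , 3≤Nε , N≤) = conclude
      (answers {M = searchWith C} {vs = Inst.code α ∷ ε ∷ []} {R = λ b → b ≡ true ⊎ Hit α}
        (exec-search α ε N (≡.cong fromℤ ⌈⌉≡N)) (λ ()) (λ b → b))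
      where
      conclude : (∃ λ t → (searchWith C ⟨ Inst.code α ∷ ε ∷ [] ⟩⇓ t) ×
        Always (λ n b → (b ≡ true ⊎ Hit α) × fromℕ n ≤ totalTime α (fromℕ N)) t ×
        hit (p α) (q α) N ≤ 𝔼 (λ b → 𝟙 (does (b Bool.≟ false))) t) → ∃ (Correct α ε)
      conclude (t , ⇓t , answer , hit≤) = t , correct α N 3≤Nε N≤ ⇓t answer hit≤

    searchWith-IsPRAX : IsPRAX 𝔽 Π (λ α → p α ≈ 0#) (λ ε α → p α ≤ ε) (searchWith C)
    searchWith-IsPRAX = searchTime ,
      λ α ε 0<ε _ → searchWith-halts α (iterations 3≤C C≤5 0<ε)

  -- The constant c = 4.76603.
  3≤c : fromℕ 3 ≤ c
  3≤c = ≤fromℕ÷fromℕ 476603 100000 3 (ℕ.<ᵇ⇒< 0 100000 tt) (ℕ.≤ᵇ⇒≤ 300000 476603 tt)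

  c≤5 : c ≤ fromℕ 5
  c≤5 = fromℕ÷fromℕ≤ 476603 100000 5 (ℕ.<ᵇ⇒< 0 100000 tt) (ℕ.≤ᵇ⇒≤ 476603 500000 tt)

  search-IsPRAX : IsPRAX 𝔽 Π (λ α → p α ≈ 0#) (λ ε α → p α ≤ ε)
                    (search SelectFinFam decide distrParameter test)
  search-IsPRAX = searchWith-IsPRAX 3≤c c≤5

-- Emptiness and universality

module _ (𝔽 : ArchimedeanField) {Object : Set} (Π : Problem Object) where

  -- A PRAX algorithm remains one for fewer instances to accept and fewer
  -- instances to reject.
  IsPRAX-⊆ : ∀ {S S′ S_ε S′_ε M} → (∀ {α} → S′ α → S α) →
             (∀ {ε α} → S_ε ε α → S′_ε ε α) →
             IsPRAX 𝔽 Π S S_ε M → IsPRAX 𝔽 Π S′ S′_ε M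
  IsPRAX-⊆ S′⊆S S_ε⊆S′_ε (time , prax) = time , λ α ε 0<ε ε<1 →
    let t , ⇓t , complete , sound , timely = prax α ε 0<ε ε<1 in
    t , ⇓t , (λ S′α → complete (S′⊆S S′α)) ,
    (λ ¬S′_ε → sound (λ S_ε → ¬S′_ε (S_ε⊆S′_ε S_ε))) , timely

corollary5p4 : (𝔽 : ArchimedeanField) (Object : Set) (objects : Coding Object)
    (T : ℕ → FiniteDistribution 𝔽 Object)
    (SelectFinFam : Algorithm 𝔽 (word ∷ []) word) →
    Samples 𝔽 objects T SelectFinFam →
    (Π : Problem Object)
    (decide : Algorithm 𝔽 (word ∷ word ∷ []) bool) →
    PolynomiallyDecides 𝔽 objects Π decide →
    (index : Problem.Instance Π → ℕ) →
    DomainsMatch 𝔽 Π T index →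
    (distrParameter : Algorithm 𝔽 (word ∷ []) word) →
    PolynomiallyComputesUnary 𝔽 Π index distrParameter →
    IsPRAX 𝔽 Π (Emptiness 𝔽 Π T index) (Emptiness≤ 𝔽 Π T index)
    (FinEmptiness 𝔽 SelectFinFam decide distrParameter)
    ×
    IsPRAX 𝔽 Π (Universality 𝔽 Π T index) (Universality≥ 𝔽 Π T index)
    (FinUniversality 𝔽 SelectFinFam decide distrParameter)
corollary5p4 𝔽 Object objects T SelectFinFam samples Π decide decides index match
             distrParameter computes = emptiness , universality
  where
  open Randomized 𝔽 using (var; neg; module SearchVariables)
  open Problem Π using (𝓛; 𝓛?)

  emptiness : IsPRAX 𝔽 Π (Emptiness 𝔽 Π T index) (Emptiness≤ 𝔽 Π T index)
                (FinEmptiness 𝔽 SelectFinFam decide distrParameter)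
  emptiness = Search.search-IsPRAX 𝔽 objects T SelectFinFam samples Π decide decides
    index match distrParameter computes 𝓛 𝓛? (var SearchVariables.b) (λ _ _ _ b≡ → b≡)

  universality : IsPRAX 𝔽 Π (Universality 𝔽 Π T index) (Universality≥ 𝔽 Π T index)
                   (FinUniversality 𝔽 SelectFinFam decide distrParameter)
  universality = IsPRAX-⊆ 𝔽 Π
    (λ {α} → Masses.massOf≈1⇒complement≈0 𝔽 (T (index α)) (𝓛? α))
    (λ {ε} {α} → Masses.complement≤⇒1-≤massOf 𝔽 (T (index α)) (𝓛? α))
    (Search.search-IsPRAX 𝔽 objects T SelectFinFam samples Π decide decides
      index match distrParameter computes
      (λ α x → ¬ 𝓛 α x) (λ α x → ¬? (𝓛? α x))
      (neg (var SearchVariables.b)) (λ _ _ _ b≡ → ≡.cong not b≡))
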